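{- Let $P$ be a fixed finite non-empty poset and let $p$ be the number of filters of $P$. For integers $n \geq 1$ define $$M(n) = \begin{cases} \max\{kn - p^{k-1}(k(p-1) - p) \mid k \geq 1 \text{ an integer and } p^{k-1}(p-1) \leq n\} & \text{if } n \geq p-1, \\ 1 & \text{otherwise,}\end{cases}$$ $$M^{\circ}(n) = \max\{kn - p^{k-1}(k(p-1) - p) + (k-1)\delta_k - k\delta_{k-1} \mid k \geq 2 \text{ an integer and } p^{k-1}(p-1) - \delta_k + \delta_{k-1} \leq n\}$$ (with $\max\emptyset = 0$). Then, as $n \to \infty$, $$M(n) = n \log_p(n)(1 + o(1)), \qquad M^{\circ}(n) = n \log_p(n)(1 + o(1)).$$
   Context: A filter of $P$ is an up-closed subset (possibly empty). For posets $P$ and $Q$, $Q^P$ is the set of order-preserving maps from $P$ to $Q$. For $k \geq 1$, $B_k$ is the Boolean lattice of subsets of a $k$-element set, $B_k^{\circ} = B_k \setminus \{\hat{1}\}$ (all proper subsets), and $\delta_k = \left|B_k^P \setminus (B_k^{\circ})^P\right|$. -}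

module Defs where

open import Data.Bool.Base using (true; false)
open import Data.Empty using (⊥-elim)
open import Data.Fin.Base using (Fin)
open import Data.Fin.Properties using (all?)
open import Data.Fin.Subset using (Subset; inside; outside; _∈_; _⊆_; ⊤; ⊥)
open import Data.Fin.Subset.Properties using (_∈?_; _⊆?_; ∈⊤; ∉⊥)
open import Data.Integer.Base as ℤ using (ℤ; +_; -[1+_]; 0ℤ; 1ℤ)
import Data.Integer.Properties as ℤ
import Data.Integer.Tactic.RingSolver as ℤ-Solver
open import Data.List.Base using (List; []; _∷_; [_]; length; filter; cartesianProductWith)
open import Data.List.Membership.Propositional using () renaming (_∈_ to _∈ₗ_)
open import Data.List.Membership.Propositional.Properties
  using (∈-filter⁺; ∈-cartesianProductWith⁺)
open import Data.List.Relation.Unary.Any using (here; there)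
open import Data.Nat.Base as ℕ
  using (ℕ; zero; suc; _^_; _∸_; z<s; s<s; NonZero; NonTrivial; pred)
import Data.Nat.Properties as ℕ
import Data.Nat.Tactic.RingSolver as ℕ-Solver
open import Data.Product.Base using (∃; ∃-syntax; _×_; _,_)
open import Data.Rational.Base using (ℚ; 1ℚ; ↥_; ↧_; ↧ₙ_; _/_; _<_; _+_; -_; _*_;
  1/_; fromℚᵘ; Positive)
import Data.Rational.Properties as ℚ
import Data.Rational.Unnormalised.Base as ℚᵘ
import Data.Rational.Unnormalised.Properties as ℚᵘ
open import Data.Sum.Base as Sum using (_⊎_; inj₁; inj₂)
open import Data.Vec.Base using (Vec; []; _∷_; lookup)
open import Data.Vec.Properties using (≡-dec)
import Data.Bool.Properties as Bool
open import Function.Base using (_∘_)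
open import Level using (0ℓ)
open import Relation.Binary.Core using (Rel)
open import Relation.Binary.PropositionalEquality
  using (_≡_; _≢_; refl; sym; trans; cong; cong₂; subst; subst₂; module ≡-Reasoning)
open import Relation.Binary.Structures using (IsDecPartialOrder)
open import Relation.Nullary using (¬_; yes; no)
open import Relation.Nullary.Decidable using (_→-dec_; _×-dec_; ¬?)
open import Relation.Unary using (Pred; Decidable; Empty) renaming (_∈_ to _∈ₚ_)

record ℝ : Set₁ where
  field
    lower upper   : Pred ℚ 0ℓ
    lower-inhab   : ∃ lower
    upper-inhab   : ∃ upper
    lower-down    : ∀ {q r} → q < r → lower r → lower q
    upper-up      : ∀ {q r} → q < r → upper q → upper r
    lower-rounded : ∀ {q} → lower q → ∃[ r ] q < r × lower r
    upper-rounded : ∀ {r} → upper r → ∃[ q ] q < r × upper q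
    disjoint      : ∀ {q} → lower q → ¬ upper q
    located       : ∀ {q r} → q < r → lower q ⊎ upper r

infix  4 _≤ʳ_
infix  8 ⊖_
infixl 7 _⊙_
infixl 6 _⊕_

_≤ʳ_ : ℝ → ℝ → Set
x ≤ʳ y = ∀ {q} → ℝ.lower x q → ℝ.lower y q

private
  -- image of x under the increasing bijection f of ℚ with inverse g
  transport : (f g : ℚ → ℚ) →
              (∀ {q r} → q < r → f q < f r) → (∀ {q r} → q < r → g q < g r) →
              (∀ q → f (g q) ≡ q) → (∀ q → g (f q) ≡ q) → ℝ → ℝ
  transport f g f-mono g-mono fg gf x = record
    { lower         = lower ∘ g
    ; upper         = upper ∘ g
    ; lower-inhab   = let q , l = lower-inhab in f q , subst lower (sym (gf q)) l
    ; upper-inhab   = let q , u = upper-inhab in f q , subst upper (sym (gf q)) u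
    ; lower-down    = lower-down ∘ g-mono
    ; upper-up      = upper-up ∘ g-mono
    ; lower-rounded = λ {q} l → let r , q<r , l′ = lower-rounded l in
        f r , subst (_< f r) (fg q) (f-mono q<r) , subst lower (sym (gf r)) l′
    ; upper-rounded = λ {q} u → let r , r<q , u′ = upper-rounded u in
        f r , subst (f r <_) (fg q) (f-mono r<q) , subst upper (sym (gf r)) u′
    ; disjoint      = disjoint
    ; located       = located ∘ g-mono
    }
    where open ℝ x

  +-cancel : ∀ s q → s + (- s + q) ≡ q
  +-cancel s q = trans (sym (ℚ.+-assoc s (- s) q))
                       (trans (cong (_+ q) (ℚ.+-inverseʳ s)) (ℚ.+-identityˡ q))

  -+-cancel : ∀ s q → - s + (s + q) ≡ q
  -+-cancel s q = trans (sym (ℚ.+-assoc (- s) s q))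
                        (trans (cong (_+ q) (ℚ.+-inverseˡ s)) (ℚ.+-identityˡ q))

  *-cancel : ∀ s t q → s * t ≡ 1ℚ → s * (t * q) ≡ q
  *-cancel s t q st≡1 = trans (sym (ℚ.*-assoc s t q))
                              (trans (cong (_* q) st≡1) (ℚ.*-identityˡ q))

_⊕_ : ℚ → ℝ → ℝ
s ⊕ x = transport (λ q → s + q) (λ q → - s + q) (ℚ.+-monoʳ-< s) (ℚ.+-monoʳ-< (- s))
                  (+-cancel s) (-+-cancel s) x

_⊙_ : (c : ℚ) .{{_ : Positive c}} → ℝ → ℝ
c ⊙ x = transport (c *_) (1/c *_) (ℚ.*-monoʳ-<-pos c)
                  (ℚ.*-monoʳ-<-pos 1/c {{ℚ.1/pos⇒pos c}})
                  (λ q → *-cancel c 1/c q (ℚ.*-inverseʳ c {{c≢0}}))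
                  (λ q → *-cancel 1/c c q (ℚ.*-inverseˡ c {{c≢0}})) x
  where
  c≢0 = ℚ.pos⇒nonZero c
  1/c = (1/ c) {{c≢0}}

⊖_ : ℝ → ℝ
⊖ x = record
  { lower         = upper ∘ -_
  ; upper         = lower ∘ -_
  ; lower-inhab   = let q , u = upper-inhab in - q , subst upper (sym (neg² q)) u
  ; upper-inhab   = let q , l = lower-inhab in - q , subst lower (sym (neg² q)) l
  ; lower-down    = upper-up ∘ ℚ.neg-antimono-<
  ; upper-up      = lower-down ∘ ℚ.neg-antimono-<
  ; lower-rounded = λ {q} u → let r , r<-q , u′ = upper-rounded u in
      - r , subst (_< - r) (neg² q) (ℚ.neg-antimono-< r<-q) , subst upper (sym (neg² r)) u′
  ; upper-rounded = λ {q} l → let r , -q<r , l′ = lower-rounded l in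
      - r , subst (- r <_) (neg² q) (ℚ.neg-antimono-< -q<r) , subst lower (sym (neg² r)) l′
  ; disjoint      = λ u l → disjoint l u
  ; located       = λ q<r → Sum.swap (located (ℚ.neg-antimono-< q<r))
  }
  where
  open ℝ x
  import Algebra.Properties.Group ℚ.+-0-group as G
  neg² = G.⁻¹-involutive

infix 9 _⁺ _⁻

_⁺ _⁻ : ℤ → ℕ
(+ n)    ⁺ = n
-[1+ n ] ⁺ = 0
(+ n)    ⁻ = 0
-[1+ n ] ⁻ = suc n

private
  ⁺-⁻ : ∀ z → z ≡ + (z ⁺) ℤ.- + (z ⁻)
  ⁺-⁻ (+ n)    = sym (ℤ.+-identityʳ (+ n))
  ⁺-⁻ -[1+ n ] = refl

  ^-distribʳ : ∀ x y k → (x ℕ.* y) ^ k ≡ x ^ k ℕ.* y ^ k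
  ^-distribʳ x y zero    = refl
  ^-distribʳ x y (suc k) = trans (cong (x ℕ.* y ℕ.*_) (^-distribʳ x y k))
                                 (interchange x y (x ^ k) (y ^ k))
    where
    interchange : ∀ x y u v → x ℕ.* y ℕ.* (u ℕ.* v) ≡ x ℕ.* u ℕ.* (y ℕ.* v)
    interchange = ℕ-Solver.solve-∀

  bernoulli : ∀ x k → x ^ suc k ℕ.+ suc k ℕ.* x ^ k ℕ.≤ suc x ^ suc k
  bernoulli x zero    = ℕ.≤-reflexive (eq x)
    where
    eq : ∀ x → x ℕ.* 1 ℕ.+ (1 ℕ.+ 0) ≡ (1 ℕ.+ x) ℕ.* 1
    eq = ℕ-Solver.solve-∀
  bernoulli x (suc k) = begin
    x ℕ.* (x ℕ.* y) ℕ.+ suc (suc k) ℕ.* (x ℕ.* y)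
      ≤⟨ ℕ.m≤m+n _ (suc k ℕ.* y) ⟩
    x ℕ.* (x ℕ.* y) ℕ.+ suc (suc k) ℕ.* (x ℕ.* y) ℕ.+ suc k ℕ.* y
      ≡⟨ eq x y k ⟩
    suc x ℕ.* (x ℕ.* y ℕ.+ suc k ℕ.* y)
      ≤⟨ ℕ.*-monoʳ-≤ (suc x) (bernoulli x k) ⟩
    suc x ℕ.* suc x ^ suc k ∎
    where
    open ℕ.≤-Reasoning
    y = x ^ k
    eq : ∀ x y k → x ℕ.* (x ℕ.* y) ℕ.+ (2 ℕ.+ k) ℕ.* (x ℕ.* y) ℕ.+ (1 ℕ.+ k) ℕ.* y
                 ≡ (1 ℕ.+ x) ℕ.* (x ℕ.* y ℕ.+ (1 ℕ.+ k) ℕ.* y)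
    eq = ℕ-Solver.solve-∀

  pos-*+* : ∀ a b c d → + (a ℕ.* b ℕ.+ c ℕ.* d) ≡ + a ℤ.* + b ℤ.+ + c ℤ.* + d
  pos-*+* a b c d = cong₂ ℤ._+_ (ℤ.pos-* a b) (ℤ.pos-* c d)

  cross-eq : ∀ a a⁻ c⁻ d e →
             (+ a ℤ.- + a⁻) ℤ.* + e ℤ.+ + (c⁻ ℕ.* d ℕ.+ a⁻ ℕ.* e) ≡ + (a ℕ.* e ℕ.+ c⁻ ℕ.* d)
  cross-eq a a⁻ c⁻ d e =
    trans (cong (λ t → (+ a ℤ.- + a⁻) ℤ.* + e ℤ.+ t) (pos-*+* c⁻ d a⁻ e))
          (trans (eq (+ a) (+ a⁻) (+ c⁻) (+ d) (+ e)) (sym (pos-*+* a e c⁻ d)))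
    where
    eq : ∀ a a⁻ c⁻ d e → (a ℤ.- a⁻) ℤ.* e ℤ.+ (c⁻ ℤ.* d ℤ.+ a⁻ ℤ.* e) ≡ a ℤ.* e ℤ.+ c⁻ ℤ.* d
    eq = ℤ-Solver.solve-∀

  cross-eq′ : ∀ c c⁻ a⁻ d e →
              (+ c ℤ.- + c⁻) ℤ.* + d ℤ.+ + (c⁻ ℕ.* d ℕ.+ a⁻ ℕ.* e) ≡ + (c ℕ.* d ℕ.+ a⁻ ℕ.* e)
  cross-eq′ c c⁻ a⁻ d e
    rewrite ℕ.+-comm (c⁻ ℕ.* d) (a⁻ ℕ.* e) = cross-eq c c⁻ a⁻ e d

  module _ {z w : ℤ} (a a⁻ c c⁻ d e : ℕ) (z≡ : z ≡ + a ℤ.- + a⁻) (w≡ : w ≡ + c ℤ.- + c⁻) where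

    cross-≤ : z ℤ.* + e ℤ.≤ w ℤ.* + d → a ℕ.* e ℕ.+ c⁻ ℕ.* d ℕ.≤ c ℕ.* d ℕ.+ a⁻ ℕ.* e
    cross-≤ le rewrite z≡ | w≡ = ℤ.drop‿+≤+ (subst₂ ℤ._≤_
      (cross-eq a a⁻ c⁻ d e) (cross-eq′ c c⁻ a⁻ d e)
      (ℤ.+-monoˡ-≤ (+ (c⁻ ℕ.* d ℕ.+ a⁻ ℕ.* e)) le))

    cross-< : z ℤ.* + e ℤ.< w ℤ.* + d → a ℕ.* e ℕ.+ c⁻ ℕ.* d ℕ.< c ℕ.* d ℕ.+ a⁻ ℕ.* e
    cross-< lt rewrite z≡ | w≡ = ℤ.drop‿+<+ (subst₂ ℤ._<_
      (cross-eq a a⁻ c⁻ d e) (cross-eq′ c c⁻ a⁻ d e)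
      (ℤ.+-monoˡ-< (+ (c⁻ ℕ.* d ℕ.+ a⁻ ℕ.* e)) lt))

    cross-≥ : w ℤ.* + d ℤ.≤ z ℤ.* + e → c ℕ.* d ℕ.+ a⁻ ℕ.* e ℕ.≤ a ℕ.* e ℕ.+ c⁻ ℕ.* d
    cross-≥ le rewrite z≡ | w≡ = ℤ.drop‿+≤+ (subst₂ ℤ._≤_
      (cross-eq′ c c⁻ a⁻ d e) (cross-eq a a⁻ c⁻ d e)
      (ℤ.+-monoˡ-≤ (+ (c⁻ ℕ.* d ℕ.+ a⁻ ℕ.* e)) le))

  -- b ^ ((a - a⁻) / d) is compared with n after raising both to the power d
  -- and clearing the negative exponent.
  module Compare (b n : ℕ) (1<b : 1 ℕ.< b) (0<n : 0 ℕ.< n) where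
    instance
      b≢0 : NonZero b
      b≢0 = ℕ.>-nonZero (ℕ.<-trans z<s 1<b)

      n≢0 : NonZero n
      n≢0 = ℕ.>-nonZero 0<n

    Lo Hi : (a a⁻ d : ℕ) → Set
    Lo a a⁻ d = b ^ a ℕ.< n ^ d ℕ.* b ^ a⁻
    Hi a a⁻ d = n ^ d ℕ.* b ^ a⁻ ℕ.< b ^ a

    merge : ∀ a e c d → (b ^ a) ^ e ℕ.* (b ^ c) ^ d ≡ b ^ (a ℕ.* e ℕ.+ c ℕ.* d)
    merge a e c d = trans (cong₂ ℕ._*_ (ℕ.^-*-assoc b a e) (ℕ.^-*-assoc b c d))
                          (sym (ℕ.^-distribˡ-+-* b (a ℕ.* e) (c ℕ.* d)))

    exchange : ∀ x y d e → (n ^ d ℕ.* x) ^ e ℕ.* y ^ d ≡ (n ^ e ℕ.* y) ^ d ℕ.* x ^ e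
    exchange x y d e = begin
      (n ^ d ℕ.* x) ^ e ℕ.* y ^ d       ≡⟨ cong (ℕ._* y ^ d) (^-distribʳ (n ^ d) x e) ⟩
      (n ^ d) ^ e ℕ.* x ^ e ℕ.* y ^ d   ≡⟨ cong (λ t → t ℕ.* x ^ e ℕ.* y ^ d) commute ⟩
      (n ^ e) ^ d ℕ.* x ^ e ℕ.* y ^ d   ≡⟨ rearrange ((n ^ e) ^ d) (x ^ e) (y ^ d) ⟩
      (n ^ e) ^ d ℕ.* y ^ d ℕ.* x ^ e   ≡⟨ cong (ℕ._* x ^ e) (^-distribʳ (n ^ e) y d) ⟨
      (n ^ e ℕ.* y) ^ d ℕ.* x ^ e       ∎
      where
      open ≡-Reasoning
      commute : (n ^ d) ^ e ≡ (n ^ e) ^ d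
      commute = trans (ℕ.^-*-assoc n d e)
                      (trans (cong (n ^_) (ℕ.*-comm d e)) (sym (ℕ.^-*-assoc n e d)))
      rearrange : ∀ u v w → u ℕ.* v ℕ.* w ≡ u ℕ.* w ℕ.* v
      rearrange = ℕ-Solver.solve-∀

    module _ (a a⁻ d c c⁻ e : ℕ) .{{_ : NonZero d}} .{{_ : NonZero e}} where
      open ℕ.≤-Reasoning

      private
        instance
          b^a⁻^e≢0 : NonZero ((b ^ a⁻) ^ e)
          b^a⁻^e≢0 = ℕ.m^n≢0 (b ^ a⁻) e {{ℕ.m^n≢0 b a⁻}}

      Lo-mono : a ℕ.* e ℕ.+ c⁻ ℕ.* d ℕ.≤ c ℕ.* d ℕ.+ a⁻ ℕ.* e → Lo c c⁻ e → Lo a a⁻ d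
      Lo-mono le lo = ℕ.≰⇒> λ ge → ℕ.<-irrefl refl (begin-strict
        (n ^ d ℕ.* b ^ a⁻) ^ e ℕ.* (b ^ c⁻) ^ d
          ≤⟨ ℕ.*-monoˡ-≤ ((b ^ c⁻) ^ d) (ℕ.^-monoˡ-≤ e ge) ⟩
        (b ^ a) ^ e ℕ.* (b ^ c⁻) ^ d           ≡⟨ merge a e c⁻ d ⟩
        b ^ (a ℕ.* e ℕ.+ c⁻ ℕ.* d)             ≤⟨ ℕ.^-monoʳ-≤ b le ⟩
        b ^ (c ℕ.* d ℕ.+ a⁻ ℕ.* e)             ≡⟨ merge c d a⁻ e ⟨
        (b ^ c) ^ d ℕ.* (b ^ a⁻) ^ e
          <⟨ ℕ.*-monoˡ-< ((b ^ a⁻) ^ e) (ℕ.^-monoˡ-< d lo) ⟩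
        (n ^ e ℕ.* b ^ c⁻) ^ d ℕ.* (b ^ a⁻) ^ e  ≡⟨ exchange (b ^ a⁻) (b ^ c⁻) d e ⟨
        (n ^ d ℕ.* b ^ a⁻) ^ e ℕ.* (b ^ c⁻) ^ d  ∎)

      Hi-mono : c ℕ.* d ℕ.+ a⁻ ℕ.* e ℕ.≤ a ℕ.* e ℕ.+ c⁻ ℕ.* d → Hi c c⁻ e → Hi a a⁻ d
      Hi-mono le hi = ℕ.≰⇒> λ ge → ℕ.<-irrefl refl (begin-strict
        (n ^ e ℕ.* b ^ c⁻) ^ d ℕ.* (b ^ a⁻) ^ e
          <⟨ ℕ.*-monoˡ-< ((b ^ a⁻) ^ e) (ℕ.^-monoˡ-< d hi) ⟩
        (b ^ c) ^ d ℕ.* (b ^ a⁻) ^ e           ≡⟨ merge c d a⁻ e ⟩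
        b ^ (c ℕ.* d ℕ.+ a⁻ ℕ.* e)             ≤⟨ ℕ.^-monoʳ-≤ b le ⟩
        b ^ (a ℕ.* e ℕ.+ c⁻ ℕ.* d)             ≡⟨ merge a e c⁻ d ⟨
        (b ^ a) ^ e ℕ.* (b ^ c⁻) ^ d
          ≤⟨ ℕ.*-monoˡ-≤ ((b ^ c⁻) ^ d) (ℕ.^-monoˡ-≤ e ge) ⟩
        (n ^ d ℕ.* b ^ a⁻) ^ e ℕ.* (b ^ c⁻) ^ d  ≡⟨ exchange (b ^ a⁻) (b ^ c⁻) d e ⟩
        (n ^ e ℕ.* b ^ c⁻) ^ d ℕ.* (b ^ a⁻) ^ e  ∎)

      Lo-or-Hi : a ℕ.* e ℕ.+ c⁻ ℕ.* d ℕ.< c ℕ.* d ℕ.+ a⁻ ℕ.* e → Lo a a⁻ d ⊎ Hi c c⁻ e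
      Lo-or-Hi lt with b ^ a ℕ.<? n ^ d ℕ.* b ^ a⁻
      ... | yes lo = inj₁ lo
      ... | no ¬lo = inj₂ (ℕ.≰⇒> λ ge → ℕ.<-irrefl refl (begin-strict
        (b ^ c) ^ d ℕ.* (b ^ a⁻) ^ e
          ≤⟨ ℕ.*-monoˡ-≤ ((b ^ a⁻) ^ e) (ℕ.^-monoˡ-≤ d ge) ⟩
        (n ^ e ℕ.* b ^ c⁻) ^ d ℕ.* (b ^ a⁻) ^ e  ≡⟨ exchange (b ^ a⁻) (b ^ c⁻) d e ⟨
        (n ^ d ℕ.* b ^ a⁻) ^ e ℕ.* (b ^ c⁻) ^ d
          ≤⟨ ℕ.*-monoˡ-≤ ((b ^ c⁻) ^ d) (ℕ.^-monoˡ-≤ e (ℕ.≮⇒≥ ¬lo)) ⟩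
        (b ^ a) ^ e ℕ.* (b ^ c⁻) ^ d           ≡⟨ merge a e c⁻ d ⟩
        b ^ (a ℕ.* e ℕ.+ c⁻ ℕ.* d)             <⟨ ℕ.^-monoʳ-< b 1<b lt ⟩
        b ^ (c ℕ.* d ℕ.+ a⁻ ℕ.* e)             ≡⟨ merge c d a⁻ e ⟨
        (b ^ c) ^ d ℕ.* (b ^ a⁻) ^ e           ∎))

    gap : ∀ x y → 0 ℕ.< x → x ℕ.< y → ∃[ k ] b ℕ.* x ^ suc k ℕ.< y ^ suc k
    gap x@(suc _) y 0<x x<y = k , (begin-strict
      b ℕ.* (x ℕ.* x ^ k)              ≡⟨ ℕ.*-assoc b x (x ^ k) ⟨
      b ℕ.* x ℕ.* x ^ k                ≡⟨ cong (ℕ._* x ^ k) bx≡ ⟨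
      suc k ℕ.* x ^ k                  <⟨ ℕ.m<n+m _ (ℕ.m^n>0 x (suc k)) ⟩
      x ^ suc k ℕ.+ suc k ℕ.* x ^ k    ≤⟨ bernoulli x k ⟩
      suc x ^ suc k                    ≤⟨ ℕ.^-monoˡ-≤ (suc k) x<y ⟩
      y ^ suc k                        ∎)
      where
      open ℕ.≤-Reasoning
      k = pred (b ℕ.* x)
      bx≡ : suc k ≡ b ℕ.* x
      bx≡ = ℕ.suc-pred (b ℕ.* x) {{ℕ.m*n≢0 b x}}

    power : ∀ d a⁻ k → (n ^ d ℕ.* b ^ a⁻) ^ k ≡ n ^ (d ℕ.* k) ℕ.* b ^ (a⁻ ℕ.* k)
    power d a⁻ k = trans (^-distribʳ (n ^ d) (b ^ a⁻) k)
                         (cong₂ ℕ._*_ (ℕ.^-*-assoc n d k) (ℕ.^-*-assoc b a⁻ k))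

    Lo-gap : ∀ a a⁻ d → Lo a a⁻ d → ∃[ k ] Lo (suc (a ℕ.* suc k)) (a⁻ ℕ.* suc k) (d ℕ.* suc k)
    Lo-gap a a⁻ d lo = let k , lt = gap (b ^ a) _ (ℕ.m^n>0 b a) lo in
      k , subst₂ ℕ._<_ (cong (b ℕ.*_) (ℕ.^-*-assoc b a (suc k))) (power d a⁻ (suc k)) lt

    Hi-gap : ∀ a a⁻ d → Hi a a⁻ d → ∃[ k ] Hi (a ℕ.* suc k) (suc (a⁻ ℕ.* suc k)) (d ℕ.* suc k)
    Hi-gap a a⁻ d hi =
      let k , lt = gap (n ^ d ℕ.* b ^ a⁻) (b ^ a)
                       (ℕ.*-mono-≤ (ℕ.m^n>0 n d) (ℕ.m^n>0 b a⁻)) hi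
      in k , subst₂ ℕ._<_
               (trans (cong (b ℕ.*_) (power d a⁻ (suc k)))
                      (rearrange b (n ^ (d ℕ.* suc k)) (b ^ (a⁻ ℕ.* suc k))))
               (ℕ.^-*-assoc b a (suc k)) lt
      where
      rearrange : ∀ x y z → x ℕ.* (y ℕ.* z) ≡ y ℕ.* (x ℕ.* z)
      rearrange = ℕ-Solver.solve-∀

  ↥-fromℚᵘ : ∀ w d → let r = fromℚᵘ (ℚᵘ.mkℚᵘ w d) in ↥ r ℤ.* + suc d ≡ w ℤ.* ↧ r
  ↥-fromℚᵘ w d with fromℚᵘ (ℚᵘ.mkℚᵘ w d) | ℚ.toℚᵘ-fromℚᵘ (ℚᵘ.mkℚᵘ w d)
  ... | record{} | ℚᵘ.*≡* eq = eq

  i<i+1+n : ∀ i n → i ℤ.< i ℤ.+ + suc n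
  i<i+1+n i n = subst (ℤ._< i ℤ.+ + suc n) (ℤ.+-identityʳ i) (ℤ.+-monoʳ-< i (ℤ.+<+ z<s))

  module _ (a a⁻ k d : ℕ) where
    private
      z K D : ℤ
      z = + a ℤ.- + a⁻
      K = + suc k
      D = + suc d

    step-up : z ℤ.* + (suc d ℕ.* suc k) ℤ.<
              (+ suc (a ℕ.* suc k) ℤ.- + (a⁻ ℕ.* suc k)) ℤ.* D
    step-up = subst₂ ℤ._<_
      (cong (z ℤ.*_) (sym (ℤ.pos-* (suc d) (suc k))))
      (trans (eq (+ a) (+ a⁻) D K)
             (cong₂ (λ s t → (1ℤ ℤ.+ s ℤ.- t) ℤ.* D)
                    (sym (ℤ.pos-* a (suc k))) (sym (ℤ.pos-* a⁻ (suc k)))))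
      (i<i+1+n (z ℤ.* (D ℤ.* K)) d)
      where
      eq : ∀ a a⁻ d k → (a ℤ.- a⁻) ℤ.* (d ℤ.* k) ℤ.+ d ≡ (1ℤ ℤ.+ a ℤ.* k ℤ.- a⁻ ℤ.* k) ℤ.* d
      eq = ℤ-Solver.solve-∀

    step-down : (+ (a ℕ.* suc k) ℤ.- + suc (a⁻ ℕ.* suc k)) ℤ.* D ℤ.<
                z ℤ.* + (suc d ℕ.* suc k)
    step-down = subst₂ ℤ._<_
      (cong₂ (λ s t → (s ℤ.- (1ℤ ℤ.+ t)) ℤ.* D)
             (sym (ℤ.pos-* a (suc k))) (sym (ℤ.pos-* a⁻ (suc k))))
      (trans (eq (+ a) (+ a⁻) D K) (cong (z ℤ.*_) (sym (ℤ.pos-* (suc d) (suc k)))))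
      (i<i+1+n ((+ a ℤ.* K ℤ.- (1ℤ ℤ.+ + a⁻ ℤ.* K)) ℤ.* D) d)
      where
      eq : ∀ a a⁻ d k → (a ℤ.* k ℤ.- (1ℤ ℤ.+ a⁻ ℤ.* k)) ℤ.* d ℤ.+ d ≡ (a ℤ.- a⁻) ℤ.* (d ℤ.* k)
      eq = ℤ-Solver.solve-∀

  module LogCut (b n : ℕ) (1<b : 1 ℕ.< b) (0<n : 0 ℕ.< n) where
    open Compare b n 1<b 0<n

    lower upper : Pred ℚ 0ℓ
    lower q = Lo (↥ q ⁺) (↥ q ⁻) (↧ₙ q)
    upper q = Hi (↥ q ⁺) (↥ q ⁻) (↧ₙ q)

    lower-≤ : ∀ q {w} c c⁻ e .{{_ : NonZero e}} → w ≡ + c ℤ.- + c⁻ →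
              ↥ q ℤ.* + e ℤ.≤ w ℤ.* ↧ q → Lo c c⁻ e → lower q
    lower-≤ q@record{} c c⁻ e w≡ le =
      Lo-mono (↥ q ⁺) (↥ q ⁻) (↧ₙ q) c c⁻ e
        (cross-≤ (↥ q ⁺) (↥ q ⁻) c c⁻ (↧ₙ q) e (⁺-⁻ (↥ q)) w≡ le)

    upper-≥ : ∀ q {w} c c⁻ e .{{_ : NonZero e}} → w ≡ + c ℤ.- + c⁻ →
              w ℤ.* ↧ q ℤ.≤ ↥ q ℤ.* + e → Hi c c⁻ e → upper q
    upper-≥ q@record{} c c⁻ e w≡ le =
      Hi-mono (↥ q ⁺) (↥ q ⁻) (↧ₙ q) c c⁻ e
        (cross-≥ (↥ q ⁺) (↥ q ⁻) c c⁻ (↧ₙ q) e (⁺-⁻ (↥ q)) w≡ le)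

    lower-inhab : lower (- 1ℚ)
    lower-inhab = ℕ.*-mono-≤ (ℕ.m^n>0 n 1) (ℕ.≤-trans 1<b (ℕ.≤-reflexive (sym (ℕ.*-identityʳ b))))

    upper-inhab : ∃ upper
    upper-inhab = q , upper-≥ q n 0 1 (sym (ℤ.+-identityʳ (+ n)))
                        (ℤ.≤-reflexive (sym (↥-fromℚᵘ (+ n) 0)))
                        (subst (ℕ._< b ^ n) (sym (trans (ℕ.*-identityʳ (n ^ 1)) (ℕ.^-identityʳ n))) (n<b^n n))
      where
      q = fromℚᵘ (ℚᵘ.mkℚᵘ (+ n) 0)
      n<b^n : ∀ m → m ℕ.< b ^ m
      n<b^n zero    = z<s
      n<b^n (suc m) = ℕ.<-≤-trans (s<s (n<b^n m)) (ℕ.≤-trans 1+x≤2*x (ℕ.*-monoˡ-≤ (b ^ m) 1<b))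
        where
        1+x≤2*x : suc (b ^ m) ℕ.≤ 2 ℕ.* b ^ m
        1+x≤2*x = ℕ.+-mono-≤ (ℕ.m^n>0 b m) (ℕ.m≤m+n (b ^ m) 0)

    lower-down : ∀ {q r} → q < r → lower r → lower q
    lower-down {q} {r@record{}} q<r =
      lower-≤ q (↥ r ⁺) (↥ r ⁻) (↧ₙ r) (⁺-⁻ (↥ r)) (ℤ.<⇒≤ (ℚ.drop-*<* q<r))

    upper-up : ∀ {q r} → q < r → upper q → upper r
    upper-up {q@record{}} {r} q<r =
      upper-≥ r (↥ q ⁺) (↥ q ⁻) (↧ₙ q) (⁺-⁻ (↥ q)) (ℤ.<⇒≤ (ℚ.drop-*<* q<r))

    lower-rounded : ∀ {q} → lower q → ∃[ r ] q < r × lower r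
    lower-rounded {q@record{}} l with Lo-gap (↥ q ⁺) (↥ q ⁻) (↧ₙ q) l
    ... | k , lo = r , q<r , lower-≤ r (suc (↥ q ⁺ ℕ.* suc k)) (↥ q ⁻ ℕ.* suc k) (↧ₙ q ℕ.* suc k)
                               refl (ℤ.≤-reflexive (↥-fromℚᵘ w _)) lo
      where
      w = + suc (↥ q ⁺ ℕ.* suc k) ℤ.- + (↥ q ⁻ ℕ.* suc k)
      u = ℚᵘ.mkℚᵘ w (pred (↧ₙ q ℕ.* suc k))
      r = fromℚᵘ u
      q<r : q < r
      q<r = ℚ.toℚᵘ-cancel-< (ℚᵘ.<-respʳ-≃ (ℚᵘ.≃-sym (ℚ.toℚᵘ-fromℚᵘ u)) (ℚᵘ.*<*
        (subst (λ z → z ℤ.* + (↧ₙ q ℕ.* suc k) ℤ.< w ℤ.* ↧ q) (sym (⁺-⁻ (↥ q)))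
               (step-up (↥ q ⁺) (↥ q ⁻) k _))))

    upper-rounded : ∀ {r} → upper r → ∃[ q ] q < r × upper q
    upper-rounded {r@record{}} h with Hi-gap (↥ r ⁺) (↥ r ⁻) (↧ₙ r) h
    ... | k , hi = q , q<r , upper-≥ q (↥ r ⁺ ℕ.* suc k) (suc (↥ r ⁻ ℕ.* suc k)) (↧ₙ r ℕ.* suc k)
                               refl (ℤ.≤-reflexive (sym (↥-fromℚᵘ w _))) hi
      where
      w = + (↥ r ⁺ ℕ.* suc k) ℤ.- + suc (↥ r ⁻ ℕ.* suc k)
      u = ℚᵘ.mkℚᵘ w (pred (↧ₙ r ℕ.* suc k))
      q = fromℚᵘ u
      q<r : q < r
      q<r = ℚ.toℚᵘ-cancel-< (ℚᵘ.<-respˡ-≃ (ℚᵘ.≃-sym (ℚ.toℚᵘ-fromℚᵘ u)) (ℚᵘ.*<*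
        (subst (λ z → w ℤ.* ↧ r ℤ.< z ℤ.* + (↧ₙ r ℕ.* suc k)) (sym (⁺-⁻ (↥ r)))
               (step-down (↥ r ⁺) (↥ r ⁻) k _))))

    located : ∀ {q r} → q < r → lower q ⊎ upper r
    located {q@record{}} {r@record{}} q<r =
      Lo-or-Hi (↥ q ⁺) (↥ q ⁻) (↧ₙ q) (↥ r ⁺) (↥ r ⁻) (↧ₙ r)
        (cross-< (↥ q ⁺) (↥ q ⁻) (↥ r ⁺) (↥ r ⁻) (↧ₙ q) (↧ₙ r) (⁺-⁻ (↥ q)) (⁺-⁻ (↥ r))
                 (ℚ.drop-*<* q<r))

-- For q = a / d in lowest terms, q < log_b n  ⇔  b ^ a < n ^ d, where a negative
-- exponent is moved to the other side; likewise for q > log_b n.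
log : (b n : ℕ) .{{_ : NonTrivial b}} .{{_ : NonZero n}} → ℝ
log b n = record
  { lower         = λ q → b ^ (↥ q) ⁺ ℕ.< n ^ (↧ₙ q) ℕ.* b ^ (↥ q) ⁻
  ; upper         = λ q → n ^ (↧ₙ q) ℕ.* b ^ (↥ q) ⁻ ℕ.< b ^ (↥ q) ⁺
  ; lower-inhab   = - 1ℚ , lower-inhab
  ; upper-inhab   = upper-inhab
  ; lower-down    = lower-down
  ; upper-up      = upper-up
  ; lower-rounded = lower-rounded
  ; upper-rounded = upper-rounded
  ; disjoint      = ℕ.<-asym
  ; located       = located
  }
  where open LogCut b n (ℕ.nonTrivial⇒n>1 b) (ℕ.>-nonZero⁻¹ n)

n·log : (b : ℕ) .{{_ : NonTrivial b}} (n : ℕ) .{{_ : NonZero n}} → ℝ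
n·log b n = _⊙_ (+ n / 1) {{ℚ.normalize-pos n 1}} (log b n)

-- f(n) = g(n) (1 + o(1)) for eventually positive g : for every ε > 0,
-- ∣ f(n) - g(n) ∣ ≤ ε g(n) for all sufficiently large n, with ∣x∣ ≤ y unfolded
-- to x ≤ y and - x ≤ y.
infix 4 _∼_
_∼_ : (ℕ → ℤ) → ((n : ℕ) → .{{NonZero n}} → ℝ) → Set
f ∼ g = ∀ (ε : ℚ) .{{_ : Positive ε}} → ∃[ N ] ∀ n .{{_ : NonZero n}} → N ℕ.≤ n →
  (f n / 1) ⊕ ⊖ g n ≤ʳ ε ⊙ g n  ×  (- (f n / 1)) ⊕ g n ≤ʳ ε ⊙ g n

-- A finite poset, its elements being enumerated as Fin size
record FinPoset : Set₁ where
  field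
    size              : ℕ
    _≤_               : Rel (Fin size) 0ℓ
    isDecPartialOrder : IsDecPartialOrder _≡_ _≤_
  open IsDecPartialOrder isDecPartialOrder public using (_≤?_)

count : ∀ {A : Set} {P : Pred A 0ℓ} → Decidable P → List A → ℕ
count P? xs = length (filter P? xs)

vectors : ∀ {A : Set} → List A → (m : ℕ) → List (Vec A m)
vectors xs zero    = [ [] ]
vectors xs (suc m) = cartesianProductWith _∷_ xs (vectors xs m)

subsets : (k : ℕ) → List (Subset k)
subsets = vectors (outside ∷ inside ∷ [])

module _ (P : FinPoset) where
  open FinPoset P

  IsFilter : Pred (Subset size) 0ℓ
  IsFilter S = ∀ x y → x ≤ y → x ∈ S → y ∈ S

  isFilter? : Decidable IsFilter
  isFilter? S = all? λ x → all? λ y → x ≤? y →-dec (x ∈? S →-dec y ∈? S)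

  #filters : ℕ
  #filters = count isFilter? (subsets size)

  -- A map from P to the Boolean lattice B_k is the vector of its values.
  OrderPreserving : ∀ {k} → Pred (Vec (Subset k) size) 0ℓ
  OrderPreserving f = ∀ x y → x ≤ y → lookup f x ⊆ lookup f y

  IntoProper : ∀ {k} → Pred (Vec (Subset k) size) 0ℓ
  IntoProper f = ∀ x → lookup f x ≢ ⊤

  -- the set difference of the maps into B_k and those into B_k minus its top
  NotIntoProper : ∀ {k} → Pred (Vec (Subset k) size) 0ℓ
  NotIntoProper f = OrderPreserving f × ¬ (OrderPreserving f × IntoProper f)

  orderPreserving? : ∀ {k} → Decidable (OrderPreserving {k})
  orderPreserving? f = all? λ x → all? λ y → x ≤? y →-dec lookup f x ⊆? lookup f y

  intoProper? : ∀ {k} → Decidable (IntoProper {k})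
  intoProper? f = all? λ x → ¬? (≡-dec Bool._≟_ (lookup f x) ⊤)

  notIntoProper? : ∀ {k} → Decidable (NotIntoProper {k})
  notIntoProper? f =
    orderPreserving? f ×-dec ¬? (orderPreserving? f ×-dec intoProper? f)

  δ : ℕ → ℕ
  δ k = count (notIntoProper? {k}) (vectors (subsets k) size)

private
  ∈-vectors : ∀ {A : Set} {xs : List A} → (∀ a → a ∈ₗ xs) → ∀ {m} (v : Vec A m) → v ∈ₗ vectors xs m
  ∈-vectors complete []      = here refl
  ∈-vectors complete (a ∷ v) =
    ∈-cartesianProductWith⁺ _∷_ (complete a) (∈-vectors complete v)

  ∈-subsets : ∀ {k} (S : Subset k) → S ∈ₗ subsets k
  ∈-subsets = ∈-vectors λ { false → here refl ; true → there (here refl) }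

  two-members : ∀ {A : Set} {x y : A} {xs} → x ∈ₗ xs → y ∈ₗ xs → x ≢ y → 1 ℕ.< length xs
  two-members (here refl) (here refl) x≢y = ⊥-elim (x≢y refl)
  two-members {xs = _ ∷ _ ∷ _} _ _ _      = s<s z<s
  two-members {xs = _ ∷ []} (here _) (there ())
  two-members {xs = _ ∷ []} (there ())

#filters-nonTrivial : ∀ P → .{{NonZero (FinPoset.size P)}} → NonTrivial (#filters P)
#filters-nonTrivial P = ℕ.n>1⇒nonTrivial (two-members
  (∈-filter⁺ (isFilter? P) (∈-subsets ⊥) (λ x y _ x∈⊥ → ⊥-elim (∉⊥ x∈⊥)))
  (∈-filter⁺ (isFilter? P) (∈-subsets ⊤) (λ x y _ _ → ∈⊤))
  (⊥≢⊤ (FinPoset.size P)))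
  where
  ⊥≢⊤ : ∀ n → .{{NonZero n}} → ⊥ {n} ≢ ⊤
  ⊥≢⊤ (suc n) ()

-- m = max S, with max ∅ = 0
IsMax : Pred ℤ 0ℓ → ℤ → Set
IsMax S m = (m ∈ₚ S × (∀ {v} → v ∈ₚ S → v ℤ.≤ m)) ⊎ (Empty S × m ≡ 0ℤ)

IsMax-unique : ∀ {S m m′} → IsMax S m → IsMax S m′ → m ≡ m′
IsMax-unique (inj₁ (m∈ , max)) (inj₁ (m′∈ , max′)) = ℤ.≤-antisym (max′ m∈) (max m′∈)
IsMax-unique (inj₁ (m∈ , _))   (inj₂ (S≡∅ , _))    = ⊥-elim (S≡∅ _ m∈)
IsMax-unique (inj₂ (S≡∅ , _))  (inj₁ (m′∈ , _))    = ⊥-elim (S≡∅ _ m′∈)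
IsMax-unique (inj₂ (_ , m≡0))  (inj₂ (_ , m′≡0))   = trans m≡0 (sym m′≡0)

module _ (P : FinPoset) (n : ℕ) where
  private
    p = #filters P

  MSet : Pred ℤ 0ℓ
  MSet v = ∃[ k ] 1 ℕ.≤ k
    × + (p ^ (k ∸ 1)) ℤ.* (+ p ℤ.- 1ℤ) ℤ.≤ + n
    × v ≡ + k ℤ.* + n ℤ.- + (p ^ (k ∸ 1)) ℤ.* (+ k ℤ.* (+ p ℤ.- 1ℤ) ℤ.- + p)

  IsM : ℤ → Set
  IsM m = (+ p ℤ.- 1ℤ ℤ.≤ + n → IsMax MSet m)
        × (¬ (+ p ℤ.- 1ℤ ℤ.≤ + n) → m ≡ 1ℤ)

  IsM-unique : ∀ {m m′} → IsM m → IsM m′ → m ≡ m′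
  IsM-unique (hi , lo) (hi′ , lo′) with + p ℤ.- 1ℤ ℤ.≤? + n
  ... | yes p-1≤n = IsMax-unique (hi p-1≤n) (hi′ p-1≤n)
  ... | no  p-1≰n = trans (lo p-1≰n) (sym (lo′ p-1≰n))

  M°Set : Pred ℤ 0ℓ
  M°Set v = ∃[ k ] 2 ℕ.≤ k
    × + (p ^ (k ∸ 1)) ℤ.* (+ p ℤ.- 1ℤ) ℤ.- + δ P k ℤ.+ + δ P (k ∸ 1) ℤ.≤ + n
    × v ≡ + k ℤ.* + n ℤ.- + (p ^ (k ∸ 1)) ℤ.* (+ k ℤ.* (+ p ℤ.- 1ℤ) ℤ.- + p)
            ℤ.+ (+ k ℤ.- 1ℤ) ℤ.* + δ P k ℤ.- + k ℤ.* + δ P (k ∸ 1)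

  IsM° : ℤ → Set
  IsM° = IsMax M°Set

  IsM°-unique : ∀ {m m′} → IsM° m → IsM° m′ → m ≡ m′
  IsM°-unique = IsMax-unique

{-# OPTIONS --safe #-}
module Submission where

-- Writing a_k = p^k - δ_k, the expression maximised by M° is k n - (k-1) a_k + k a_(k-1),
-- subject to a_k - a_(k-1) ≤ n; M is the case δ = 0.  A map P → B_k is a k-tuple of
-- filters, and if it attains the top then some x ∈ P lies in all of them.  The empty
-- filter is thus excluded, whence δ_k ≤ |P| (p-1)^k = o(p^k).  The constraint then forces
-- p^k = O(n), so that every value is at most n log_p n + O(n).  Conversely
-- k = log_p n - O(1), the O(1) depending on ε, is admissible and its value is at least
-- k n - O(k p^k) ≥ (1 - ε) n log_p n.

open import Defs
import Algebra.Properties.Group as Group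
import Data.Bool.Properties as Bool
open import Data.Bool.Base using (true; false)
open import Data.Fin.Base using (Fin; zero; suc)
open import Data.Fin.Properties using (¬∀⟶∃¬)
open import Data.Fin.Subset using (Subset; inside; outside; _∈_; ⊤; ⊥)
open import Data.Fin.Subset.Properties using (_∈?_; ∈⊤; ∉⊥)
open import Data.Integer using (ℤ; +_; 0ℤ; 1ℤ)
import Data.Integer as ℤ
import Data.Integer.Properties as ℤ
import Data.Integer.Tactic.RingSolver as ℤ-Solver
open import Data.List.Base
  using (List; []; _∷_; _++_; length; filter; map; concatMap; cartesianProductWith; allFin)
open import Data.List.Membership.Propositional using (lose) renaming (_∈_ to _∈ₗ_)
open import Data.List.Membership.Propositional.Properties
  using (∈-∃++; ∈-++⁺ˡ; ∈-++⁺ʳ; ∈-++⁻; ∈-map⁺; ∈-concatMap⁺; ∈-allFin; ∈-filter⁺; ∈-filter⁻;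
         ∈-cartesianProductWith⁺)
import Data.List.Properties as List
open import Data.List.Relation.Binary.Subset.Propositional using () renaming (_⊆_ to _⊆ₗ_)
open import Data.List.Relation.Unary.All using ([]; _∷_)
open import Data.List.Relation.Unary.All.Properties using (All¬⇒¬Any)
open import Data.List.Relation.Unary.AllPairs using ([]; _∷_)
open import Data.List.Relation.Unary.Any using (here; there)
open import Data.List.Relation.Unary.Unique.Propositional using (Unique)
import Data.List.Relation.Unary.Unique.Propositional.Properties as Unique
open import Data.Nat using (ℕ; zero; suc; pred; _+_; _*_; _^_; _∸_; _≤_; _<_; z≤n; s≤s; z<s;
  NonZero; NonTrivial)
import Data.Nat as ℕ
import Data.Nat.Properties as ℕ
import Data.Nat.Tactic.RingSolver as ℕ-Solver
open import Data.Product using (∃; ∃-syntax; _×_; _,_; proj₁; proj₂)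
open import Data.Rational.Base using (ℚ; mkℚ; ↧_; ↧ₙ_; 1/_; Positive; toℚᵘ)
import Data.Rational.Base as ℚ
open import Data.Rational.Literals using (fromℤ)
import Data.Rational.Properties as ℚ
import Data.Rational.Unnormalised.Base as ℚᵘ
import Data.Rational.Unnormalised.Properties as ℚᵘ
open import Data.Sum.Base using (inj₁; inj₂)
open import Data.Vec.Base using (Vec; []; _∷_; lookup; tabulate)
open import Data.Vec.Properties
  using (≡-dec; ∷-injective; tabulate-cong; tabulate∘lookup; lookup∘tabulate; lookup⇒[]=; []=⇒lookup)
open import Function.Base using (_∘_; id)
open import Level using (0ℓ)
open import Relation.Binary.Definitions using (tri<; tri≈; tri>)
open import Relation.Binary.PropositionalEquality
open import Relation.Nullary using (¬_; yes; no; contradiction)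
open import Relation.Nullary.Decidable using (¬?; _×-dec_; decidable-stable)
open import Relation.Unary using (Pred; Decidable)

-- Counting the maps that attain the top

-- Induction on `xs`: deleting one occurrence of the head from `ys` leaves a list that still
-- contains the tail, in which the head does not recur. As `ys` may have repetitions, it can serve
-- as an overlapping cover.
Unique-⊆⇒length-≤ : ∀ {A : Set} {xs ys : List A} → Unique xs → xs ⊆ₗ ys → length xs ≤ length ys
Unique-⊆⇒length-≤ []           xs⊆ys = z≤n
Unique-⊆⇒length-≤ {xs = x ∷ xs} (x∉xs ∷ xs!) xs⊆ys with ∈-∃++ (xs⊆ys (here refl))
... | us , vs , refl = begin
  suc (length xs)              ≤⟨ s≤s (Unique-⊆⇒length-≤ xs! xs⊆us++vs) ⟩
  suc (length (us ++ vs))      ≡⟨ cong suc (List.length-++ us) ⟩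
  suc (length us + length vs)  ≡⟨ ℕ.+-suc (length us) (length vs) ⟨
  length us + suc (length vs)  ≡⟨ List.length-++ us ⟨
  length (us ++ x ∷ vs)        ∎
  where
  open ℕ.≤-Reasoning
  xs⊆us++vs : xs ⊆ₗ us ++ vs
  xs⊆us++vs y∈xs with ∈-++⁻ us (xs⊆ys (there y∈xs))
  ... | inj₁ y∈us         = ∈-++⁺ˡ y∈us
  ... | inj₂ (there y∈vs) = ∈-++⁺ʳ us y∈vs
  ... | inj₂ (here refl)  = contradiction y∈xs (All¬⇒¬Any x∉xs)

module _ {A : Set} where

  length-cartesianProductWith : ∀ {B C : Set} (f : A → B → C) xs ys →
    length (cartesianProductWith f xs ys) ≡ length xs * length ys
  length-cartesianProductWith f []       ys = refl
  length-cartesianProductWith f (x ∷ xs) ys =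
    trans (List.length-++ (map (f x) ys))
          (cong₂ _+_ (List.length-map (f x) ys) (length-cartesianProductWith f xs ys))

  length-vectors : ∀ (xs : List A) m → length (vectors xs m) ≡ length xs ^ m
  length-vectors xs zero    = refl
  length-vectors xs (suc m) =
    trans (length-cartesianProductWith _∷_ xs (vectors xs m))
          (cong (length xs *_) (length-vectors xs m))

  length-concatMap-≤ : ∀ {B : Set} (f : A → List B) {b} → (∀ x → length (f x) ≤ b) → ∀ xs →
    length (concatMap f xs) ≤ length xs * b
  length-concatMap-≤ f f≤b []       = z≤n
  length-concatMap-≤ f f≤b (x ∷ xs) = ℕ.≤-trans (ℕ.≤-reflexive (List.length-++ (f x)))
    (ℕ.+-mono-≤ (f≤b x) (length-concatMap-≤ f f≤b xs))

  ∈-vectors : ∀ {xs : List A} {m} (v : Vec A m) → (∀ i → lookup v i ∈ₗ xs) → v ∈ₗ vectors xs m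
  ∈-vectors []      _    = here refl
  ∈-vectors (a ∷ v) v∈xs = ∈-cartesianProductWith⁺ _∷_ (v∈xs zero) (∈-vectors v (v∈xs ∘ suc))

  vectors-unique : ∀ {xs : List A} m → Unique xs → Unique (vectors xs m)
  vectors-unique zero    xs! = [] ∷ []
  vectors-unique (suc m) xs! =
    Unique.cartesianProductWith⁺ _∷_ ∷-injective xs! (vectors-unique m xs!)

  transpose : ∀ {m n} → Vec (Vec A n) m → Vec (Vec A m) n
  transpose f = tabulate λ i → tabulate λ x → lookup (lookup f x) i

  lookup-transpose : ∀ {m n} (f : Vec (Vec A n) m) i x →
    lookup (lookup (transpose f) i) x ≡ lookup (lookup f x) i
  lookup-transpose f i x = trans (cong (λ v → lookup v x) (lookup∘tabulate _ i)) (lookup∘tabulate _ x)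

  transpose-involutive : ∀ {m n} (f : Vec (Vec A n) m) → transpose (transpose f) ≡ f
  transpose-involutive f = trans
    (tabulate-cong λ x → trans (tabulate-cong λ i → lookup-transpose f i x) (tabulate∘lookup _))
    (tabulate∘lookup f)

subsets-unique : ∀ k → Unique (subsets k)
subsets-unique k = vectors-unique k (((λ ()) ∷ []) ∷ [] ∷ [])

∈-subsets : ∀ {k} (S : Subset k) → S ∈ₗ subsets k
∈-subsets S = ∈-vectors S λ i → ∈-sides (lookup S i)
  where
  ∈-sides : ∀ s → s ∈ₗ outside ∷ inside ∷ []
  ∈-sides false = here refl
  ∈-sides true  = there (here refl)

module _ (P : FinPoset) where
  open FinPoset P using (size)

  filters : List (Subset size)
  filters = filter (isFilter? P) (subsets size)

  filtersThrough : Fin size → List (Subset size)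
  filtersThrough x = filter (x ∈?_) filters

  filtersThrough-< : ∀ x → length (filtersThrough x) < #filters P
  filtersThrough-< x = List.filter-notAll (x ∈?_) filters (lose ⊥∈filters ∉⊥)
    where
    ⊥∈filters : ⊥ ∈ₗ filters
    ⊥∈filters = ∈-filter⁺ (isFilter? P) (∈-subsets ⊥) λ x y _ x∈⊥ → contradiction x∈⊥ ∉⊥

  -- A map f : P → B_k is the k-tuple of the filters { y ∣ i ∈ f y }, and f x = ⊤ says
  -- that all of them contain x; the empty filter does not.
  topAt : ∀ k → Fin size → List (Vec (Subset k) size)
  topAt k x = map transpose (vectors (filtersThrough x) k)

  NotIntoProper⇒∈topAt : ∀ {k} (f : Vec (Subset k) size) → NotIntoProper P f → ∃[ x ] f ∈ₗ topAt k x
  NotIntoProper⇒∈topAt {k} f (mono , ¬proper) =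
    x , subst (_∈ₗ topAt k x) (transpose-involutive f)
              (∈-map⁺ transpose (∈-vectors (transpose f) λ i →
                 ∈-filter⁺ (x ∈?_) (∈-filter⁺ (isFilter? P) (∈-subsets _) (filter-i i)) (x∈ i)))
    where
    ∈⇒∈ᵀ : ∀ {y i} → i ∈ lookup f y → y ∈ lookup (transpose f) i
    ∈⇒∈ᵀ {y} {i} i∈fy = lookup⇒[]= y _ (trans (lookup-transpose f i y) ([]=⇒lookup i∈fy))

    ∈ᵀ⇒∈ : ∀ {y i} → y ∈ lookup (transpose f) i → i ∈ lookup f y
    ∈ᵀ⇒∈ {y} {i} y∈ = lookup⇒[]= i _ (trans (sym (lookup-transpose f i y)) ([]=⇒lookup y∈))

    filter-i : ∀ i → IsFilter P (lookup (transpose f) i)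
    filter-i i y z y≤z y∈ = ∈⇒∈ᵀ (mono y z y≤z (∈ᵀ⇒∈ y∈))

    -- `¬proper` only refutes that all values avoid the top; finiteness of `P` and decidable
    -- equality turn this into a witness.
    reachesTop : ∃[ x ] ¬ (lookup f x ≢ ⊤)
    reachesTop = ¬∀⟶∃¬ size (λ x → lookup f x ≢ ⊤) (λ x → ¬? (≡-dec Bool._≟_ (lookup f x) ⊤))
                   (λ proper → ¬proper (mono , proper))

    x = proj₁ reachesTop

    x∈ : ∀ i → x ∈ lookup (transpose f) i
    x∈ i = ∈⇒∈ᵀ (subst (i ∈_)
      (sym (decidable-stable (≡-dec Bool._≟_ (lookup f x) ⊤) (proj₂ reachesTop))) ∈⊤)

  -- Union bound over the point at which the top is attained. The lists `topAt k x` overlap for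
  -- different `x`, which is harmless for an upper bound.
  δ-≤ : ∀ {q} → #filters P ≡ suc q → ∀ k → δ P k ≤ size * q ^ k
  δ-≤ {q} p≡ k = begin
    δ P k                                       ≤⟨ Unique-⊆⇒length-≤ unique covered ⟩
    length (concatMap (topAt k) (allFin size))  ≤⟨ length-concatMap-≤ _ topAt-≤ (allFin size) ⟩
    length (allFin size) * q ^ k                ≡⟨ cong (_* q ^ k) (List.length-tabulate {n = size} id) ⟩
    size * q ^ k                                ∎
    where
    open ℕ.≤-Reasoning
    maps : List (Vec (Subset k) size)
    maps = vectors (subsets k) size

    unique : Unique (filter (notIntoProper? P) maps)
    unique = Unique.filter⁺ (notIntoProper? P) (vectors-unique size (subsets-unique k))

    covered : filter (notIntoProper? P) maps ⊆ₗ concatMap (topAt k) (allFin size)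
    covered {f} f∈ =
      let x , f∈x = NotIntoProper⇒∈topAt f (proj₂ (∈-filter⁻ (notIntoProper? P) {xs = maps} f∈))
      in ∈-concatMap⁺ (topAt k) (lose (∈-allFin x) f∈x)

    topAt-≤ : ∀ x → length (topAt k x) ≤ q ^ k
    topAt-≤ x = begin
      length (topAt k x)                    ≡⟨ List.length-map transpose (vectors (filtersThrough x) k) ⟩
      length (vectors (filtersThrough x) k) ≡⟨ length-vectors (filtersThrough x) k ⟩
      length (filtersThrough x) ^ k
        ≤⟨ ℕ.^-monoˡ-≤ k (ℕ.s≤s⁻¹ (ℕ.≤-trans (filtersThrough-< x) (ℕ.≤-reflexive p≡))) ⟩
      q ^ k                                 ∎

-- Dedekind cuts

lower<upper : ∀ x {q r} → ℝ.lower x q → ℝ.upper x r → q ℚ.< r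
lower<upper x {q} {r} l u with ℚ.<-cmp q r
... | tri< q<r _ _  = q<r
... | tri≈ _ refl _ = contradiction u (ℝ.disjoint x l)
... | tri> _ _ r<q  = contradiction u (ℝ.disjoint x (ℝ.lower-down x r<q l))

module _ (c : ℚ) .{{c>0 : Positive c}} where
  private
    instance
      c≢0 : ℚ.NonZero c
      c≢0 = ℚ.pos⇒nonZero c
      1/c>0 : Positive (1/ c)
      1/c>0 = ℚ.1/pos⇒pos c

  1/c*[c*q]≡q : ∀ q → 1/ c ℚ.* (c ℚ.* q) ≡ q
  1/c*[c*q]≡q q = trans (sym (ℚ.*-assoc (1/ c) c q))
                        (trans (cong (ℚ._* q) (ℚ.*-inverseˡ c)) (ℚ.*-identityˡ q))

  q<c*r⇒1/c*q<r : ∀ {q r} → q ℚ.< c ℚ.* r → 1/ c ℚ.* q ℚ.< r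
  q<c*r⇒1/c*q<r {q} {r} q<cr = subst (1/ c ℚ.* q ℚ.<_) (1/c*[c*q]≡q r) (ℚ.*-monoʳ-<-pos (1/ c) q<cr)

  ⊙-lower : ∀ x {q} → ℝ.lower x q → ℝ.lower (c ⊙ x) (c ℚ.* q)
  ⊙-lower x {q} = subst (ℝ.lower x) (sym (1/c*[c*q]≡q q))

  ⊙-upper : ∀ x {q} → ℝ.upper x q → ℝ.upper (c ⊙ x) (c ℚ.* q)
  ⊙-upper x {q} = subst (ℝ.upper x) (sym (1/c*[c*q]≡q q))

neg-<-swap : ∀ {a b} → a ℚ.< ℚ.- b → b ℚ.< ℚ.- a
neg-<-swap {a} {b} a<-b =
  subst (ℚ._< ℚ.- a) (Group.⁻¹-involutive ℚ.+-0-group b) (ℚ.neg-antimono-< a<-b)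

-- Both s - y and y - s are shown to be at most ε A, which is below ε y.
module _ (y : ℝ) {A : ℚ} (s ε : ℚ) .{{_ : Positive ε}} (lowerA : ℝ.lower y A) where
  open ℚ.≤-Reasoning
  open Group ℚ.+-0-group using (\\-leftDividesʳ; \\-leftDividesˡ)

  ⊕⊖-≤-⊙ : s ℚ.≤ A ℚ.+ ε ℚ.* A → s ⊕ ⊖ y ≤ʳ ε ⊙ y
  ⊕⊖-≤-⊙ s≤A+εA {q} u = ℝ.lower-down y (q<c*r⇒1/c*q<r ε (begin-strict
    q                            ≡⟨ \\-leftDividesˡ s q ⟨
    s ℚ.+ (ℚ.- s ℚ.+ q)          ≡⟨ ℚ.+-comm s (ℚ.- s ℚ.+ q) ⟩
    -- `u` places `- (- s + q)` in the upper cut of `y`, hence above `A`.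
    ℚ.- s ℚ.+ q ℚ.+ s            <⟨ ℚ.+-monoˡ-< s (neg-<-swap (lower<upper y lowerA u)) ⟩
    ℚ.- A ℚ.+ s                  ≤⟨ ℚ.+-monoʳ-≤ (ℚ.- A) s≤A+εA ⟩
    ℚ.- A ℚ.+ (A ℚ.+ ε ℚ.* A)    ≡⟨ \\-leftDividesʳ A (ε ℚ.* A) ⟩
    ε ℚ.* A                      ∎)) lowerA

  -⊕-≤-⊙ : ∀ {U} → ℝ.upper y U → U ℚ.≤ s ℚ.+ ε ℚ.* A → (ℚ.- s) ⊕ y ≤ʳ ε ⊙ y
  -⊕-≤-⊙ {U} upperU U≤s+εA {q} l = ℝ.lower-down y (q<c*r⇒1/c*q<r ε (begin-strict
    q                                  ≡⟨ \\-leftDividesˡ (ℚ.- s) q ⟨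
    ℚ.- s ℚ.+ (ℚ.- ℚ.- s ℚ.+ q)        <⟨ ℚ.+-monoʳ-< (ℚ.- s) (lower<upper y l upperU) ⟩
    ℚ.- s ℚ.+ U                        ≤⟨ ℚ.+-monoʳ-≤ (ℚ.- s) U≤s+εA ⟩
    ℚ.- s ℚ.+ (s ℚ.+ ε ℚ.* A)          ≡⟨ \\-leftDividesʳ s (ε ℚ.* A) ⟩
    ε ℚ.* A                            ∎)) lowerA

-- `i ℚ./ 1` is normalised by a gcd and does not compute for a variable `i`, whereas `fromℤ i` has
-- numerator `i` and denominator 1 by definition.
/1≡fromℤ : ∀ i → i ℚ./ 1 ≡ fromℤ i
/1≡fromℤ i = ℚ.↥p/↧p≡p (fromℤ i)

fromℤ-* : ∀ i j → fromℤ i ℚ.* fromℤ j ≡ fromℤ (i ℤ.* j)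
fromℤ-* i j = ℚ.toℚᵘ-injective (ℚᵘ.≃-trans (ℚ.toℚᵘ-homo-* (fromℤ i) (fromℤ j)) (ℚᵘ.*≡* refl))

-- The numerator a of ε is at least 1.
fromℤ-≤ : ∀ (ε : ℚ) .{{_ : Positive ε}} i j k → ↧ ε ℤ.* i ℤ.≤ ↧ ε ℤ.* j ℤ.+ + k →
          fromℤ i ℚ.≤ fromℤ j ℚ.+ ε ℚ.* fromℤ (+ k)
fromℤ-≤ ε@(mkℚ (+ a@(suc a-1)) d-1 _) i j k di≤dj+k = ℚ.toℚᵘ-cancel-≤ (begin
  toℚᵘ (fromℤ i)                                     ≤⟨ ℚᵘ.*≤* cross ⟩
  toℚᵘ (fromℤ j) ℚᵘ.+ toℚᵘ ε ℚᵘ.* toℚᵘ (fromℤ (+ k))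
    ≃⟨ ℚᵘ.+-congʳ (toℚᵘ (fromℤ j)) (ℚ.toℚᵘ-homo-* ε (fromℤ (+ k))) ⟨
  toℚᵘ (fromℤ j) ℚᵘ.+ toℚᵘ (ε ℚ.* fromℤ (+ k))
    ≃⟨ ℚ.toℚᵘ-homo-+ (fromℤ j) (ε ℚ.* fromℤ (+ k)) ⟨
  toℚᵘ (fromℤ j ℚ.+ ε ℚ.* fromℤ (+ k))               ∎)
  where
  open ℚᵘ.≤-Reasoning
  d = suc d-1
  1*[d*1]≡d : 1 * (d * 1) ≡ d
  1*[d*1]≡d = trans (ℕ.*-identityˡ _) (ℕ.*-identityʳ d)
  -- The cross-multiplied inequality of unnormalised fractions, with the trivial denominators still
  -- in place.
  cross : i ℤ.* + (1 * (d * 1)) ℤ.≤ (j ℤ.* + (d * 1) ℤ.+ + a ℤ.* + k ℤ.* + 1) ℤ.* + 1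
  cross = subst₂ ℤ._≤_
    (trans (ℤ.*-comm (+ d) i) (cong (λ t → i ℤ.* + t) (sym 1*[d*1]≡d)))
    (sym (trans (ℤ.*-identityʳ _) (cong₂ ℤ._+_
      (trans (cong (λ t → j ℤ.* + t) (ℕ.*-identityʳ d)) (ℤ.*-comm j (+ d)))
      (ℤ.*-identityʳ (+ a ℤ.* + k)))))
    (ℤ.≤-trans di≤dj+k (ℤ.+-monoʳ-≤ (+ d ℤ.* j)
      (subst (+ k ℤ.≤_) (ℤ.pos-* a k) (ℤ.+≤+ (ℕ.m≤m+n k (a-1 * k))))))

-- From integer estimates to the asymptotic relation

module _ (b : ℕ) .{{b>1 : NonTrivial b}} where
  private
    n/1*l≡n*l : ∀ n l → (+ n ℚ./ 1) ℚ.* fromℤ (+ l) ≡ fromℤ (+ (n * l))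
    n/1*l≡n*l n l = trans (cong (ℚ._* fromℤ (+ l)) (/1≡fromℤ (+ n)))
                          (trans (fromℤ-* (+ n) (+ l)) (cong fromℤ (sym (ℤ.pos-* n l))))

    n^1*1≡n : ∀ n → n ^ 1 * 1 ≡ n
    n^1*1≡n n = trans (ℕ.*-identityʳ (n ^ 1)) (ℕ.^-identityʳ n)

  -- At an integer `l` the lower cut of `log b n` reads `b ^ l < n ^ 1 * 1`; scaling by `n` carries
  -- `l` to `n * l`.
  n·log-lower : ∀ n .{{_ : NonZero n}} {l} → b ^ l < n → ℝ.lower (n·log b n) (fromℤ (+ (n * l)))
  n·log-lower n {l} b^l<n = subst (ℝ.lower (n·log b n)) (n/1*l≡n*l n l)
    (⊙-lower (+ n ℚ./ 1) {{ℚ.normalize-pos n 1}} (log b n)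
      (subst (b ^ l <_) (sym (n^1*1≡n n)) b^l<n))

  n·log-upper : ∀ n .{{_ : NonZero n}} {l} → n < b ^ l → ℝ.upper (n·log b n) (fromℤ (+ (n * l)))
  n·log-upper n {l} n<b^l = subst (ℝ.upper (n·log b n)) (n/1*l≡n*l n l)
    (⊙-upper (+ n ℚ./ 1) {{ℚ.normalize-pos n 1}} (log b n)
      (subst (_< b ^ l) (sym (n^1*1≡n n)) n<b^l))

  -- As l < log_b n < l + 2, this implies ∣ v - n log_b n ∣ ≤ (n log_b n) / E.
  Close : ℕ → ℕ → ℤ → Set
  Close E n v = ∃[ l ] b ^ l < n × n < b ^ (l + 2)
    × + E ℤ.* v ℤ.≤ + E ℤ.* + (n * l) ℤ.+ + (n * l)
    × + E ℤ.* + (n * (l + 2)) ℤ.≤ + E ℤ.* v ℤ.+ + (n * l)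

  -- Tolerances 1 / E suffice: a positive ε is at least the reciprocal of its denominator.
  ∼-intro : ∀ {M : ℕ → ℤ} →
    (∀ E .{{_ : NonZero E}} → ∃[ N ] ∀ n → N ≤ n → Close E n (M n)) → M ∼ n·log b
  ∼-intro {M} close ε with close (↧ₙ ε)
  ... | N , closeN = N , λ n N≤n → let l , b^l<n , n<b^l+2 , above , below = closeN n N≤n in
      (λ {q} → subst (λ s → s ⊕ ⊖ n·log b n ≤ʳ ε ⊙ n·log b n) (sym (/1≡fromℤ (M n)))
         (λ {q} → ⊕⊖-≤-⊙ (n·log b n) (fromℤ (M n)) ε (n·log-lower n b^l<n)
           (fromℤ-≤ ε (M n) (+ (n * l)) (n * l) above) {q}) {q})
    , (λ {q} → subst (λ s → (ℚ.- s) ⊕ n·log b n ≤ʳ ε ⊙ n·log b n) (sym (/1≡fromℤ (M n)))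
         (λ {q} → -⊕-≤-⊙ (n·log b n) (fromℤ (M n)) ε (n·log-lower n b^l<n) (n·log-upper n n<b^l+2)
           (fromℤ-≤ ε (+ (n * (l + 2))) (M n) (n * l) below) {q}) {q})

-- The maxima

IsMax-resp : ∀ {S T : Pred ℤ 0ℓ} → (∀ {v} → S v → T v) → (∀ {v} → T v → S v) →
             ∀ {m} → IsMax S m → IsMax T m
IsMax-resp S⊆T T⊆S (inj₁ (m∈S , max)) = inj₁ (S⊆T m∈S , λ v∈T → max (T⊆S v∈T))
IsMax-resp S⊆T T⊆S (inj₂ (S≡∅ , m≡0)) = inj₂ ((λ v v∈T → S≡∅ v (T⊆S v∈T)) , m≡0)

module _ {Q : Pred ℕ 0ℓ} (Q? : Decidable Q) (V : ℕ → ℤ) where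
  private
    Below : ℕ → Pred ℤ 0ℓ
    Below B v = ∃[ j ] j < B × Q j × v ≡ V j

    weaken : ∀ {B v} → Below B v → Below (suc B) v
    weaken (j , j<B , rest) = j , ℕ.m<n⇒m<1+n j<B , rest

    maxBelow : ∀ B → ∃ (IsMax (Below B))
    maxBelow zero = 0ℤ , inj₂ ((λ { v (_ , () , _) }) , refl)
    maxBelow (suc B) with Q? B | maxBelow B
    ... | no ¬QB | m , isMax = m , IsMax-resp weaken strengthen isMax
      where
      strengthen : ∀ {v} → Below (suc B) v → Below B v
      strengthen (j , j<1+B , Qj , v≡) with ℕ.m<1+n⇒m<n∨m≡n j<1+B
      ... | inj₁ j<B  = j , j<B , Qj , v≡
      ... | inj₂ refl = contradiction Qj ¬QB
    ... | yes QB | m , inj₂ (empty , _) = V B , inj₁ ((B , ℕ.≤-refl , QB , refl) , max)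
      where
      max : ∀ {v} → Below (suc B) v → v ℤ.≤ V B
      max {v} (j , j<1+B , Qj , v≡) with ℕ.m<1+n⇒m<n∨m≡n j<1+B
      ... | inj₁ j<B  = contradiction (j , j<B , Qj , v≡) (empty v)
      ... | inj₂ refl = ℤ.≤-reflexive v≡
    ... | yes QB | m , inj₁ (m∈ , max) with ℤ.≤-total m (V B)
    ... | inj₁ m≤VB = V B , inj₁ ((B , ℕ.≤-refl , QB , refl) , max′)
      where
      max′ : ∀ {v} → Below (suc B) v → v ℤ.≤ V B
      max′ (j , j<1+B , Qj , v≡) with ℕ.m<1+n⇒m<n∨m≡n j<1+B
      ... | inj₁ j<B  = ℤ.≤-trans (max (j , j<B , Qj , v≡)) m≤VB
      ... | inj₂ refl = ℤ.≤-reflexive v≡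
    ... | inj₂ VB≤m = m , inj₁ (weaken m∈ , max′)
      where
      max′ : ∀ {v} → Below (suc B) v → v ℤ.≤ m
      max′ (j , j<1+B , Qj , v≡) with ℕ.m<1+n⇒m<n∨m≡n j<1+B
      ... | inj₁ j<B  = max (j , j<B , Qj , v≡)
      ... | inj₂ refl = ℤ.≤-trans (ℤ.≤-reflexive v≡) VB≤m

  -- Linear search through the finitely many indices below `B`; decidability of `Q` settles which
  -- disjunct of `IsMax` holds.
  bounded⇒IsMax : ∀ B → (∀ {j} → Q j → j < B) → ∃ (IsMax (λ v → ∃[ j ] Q j × v ≡ V j))
  bounded⇒IsMax B Q⇒<B = let m , isMax = maxBelow B in
    m , IsMax-resp (λ (j , _ , rest) → j , rest) (λ (j , Qj , v≡) → j , Q⇒<B Qj , Qj , v≡) isMax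

-- Growth of powers and integer bounds for the logarithm

n<b^n : ∀ b .{{_ : NonTrivial b}} n → n < b ^ n
n<b^n b zero    = z<s
n<b^n b (suc n) = begin-strict
  suc n                ≤⟨ n<b^n b n ⟩
  b ^ n                <⟨ ℕ.^-monoʳ-< b (ℕ.nonTrivial⇒n>1 b) (ℕ.n<1+n n) ⟩
  b ^ suc n            ∎
  where open ℕ.≤-Reasoning

b^m<b^n⇒m<n : ∀ b .{{_ : NonTrivial b}} {m n} → b ^ m < b ^ n → m < n
b^m<b^n⇒m<n b {m} {n} lt = ℕ.≰⇒> λ n≤m → ℕ.<⇒≱ lt (ℕ.^-monoʳ-≤ b {{ℕ.nonTrivial⇒nonZero b}} n≤m)

-- Descent to the largest `l` with `b ^ l < n` gives `n ≤ b ^ suc l`. Equality is possible there,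
-- and the cuts of the logarithm are strict, so the upper exponent is raised once more.
floor-log : ∀ b .{{_ : NonTrivial b}} n → 1 < n → ∃[ l ] b ^ l < n × n < b ^ (l + 2)
floor-log b n 1<n = go n (ℕ.<⇒≤ (n<b^n b n))
  where
  go : ∀ k → n ≤ b ^ k → ∃[ l ] b ^ l < n × n < b ^ (l + 2)
  go zero    n≤1 = contradiction 1<n (ℕ.≤⇒≯ n≤1)
  go (suc k) n≤b^1+k with b ^ k ℕ.<? n
  ... | yes b^k<n = k , b^k<n , ℕ.≤-<-trans n≤b^1+k
                      (ℕ.^-monoʳ-< b (ℕ.nonTrivial⇒n>1 b) (ℕ.≤-reflexive (ℕ.+-comm 2 k)))
  ... | no  b^k≮n = go k (ℕ.≮⇒≥ b^k≮n)

-- Bernoulli's inequality (1 + 1/q)^k ≥ 1 + k/q with denominators cleared.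
[q+k]*q^k≤q*[1+q]^k : ∀ q k → (q + k) * q ^ k ≤ q * suc q ^ k
[q+k]*q^k≤q*[1+q]^k q zero    = ℕ.*-monoˡ-≤ 1 (ℕ.≤-reflexive (ℕ.+-identityʳ q))
[q+k]*q^k≤q*[1+q]^k q (suc k) = begin
  (q + suc k) * (q * q ^ k)                ≤⟨ ℕ.m≤m+n _ (k * q ^ k) ⟩
  (q + suc k) * (q * q ^ k) + k * q ^ k    ≡⟨ eq q k (q ^ k) ⟩
  suc q * ((q + k) * q ^ k)                ≤⟨ ℕ.*-monoʳ-≤ (suc q) ([q+k]*q^k≤q*[1+q]^k q k) ⟩
  suc q * (q * suc q ^ k)                  ≡⟨ eq′ (suc q) q (suc q ^ k) ⟩
  q * (suc q * suc q ^ k)                  ∎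
  where
  open ℕ.≤-Reasoning
  eq : ∀ q k x → (q + (1 + k)) * (q * x) + k * x ≡ (1 + q) * ((q + k) * x)
  eq = ℕ-Solver.solve-∀
  eq′ : ∀ a b c → a * (b * c) ≡ b * (a * c)
  eq′ = ℕ-Solver.solve-∀

-- An explicit threshold for q^k = o((1+q)^k): after multiplication by `q`, Bernoulli's inequality
-- leaves only `a * q ≤ q + k`.
geometric-≪ : ∀ q .{{_ : NonZero q}} a k → a * q ≤ k → a * q ^ k ≤ suc q ^ k
geometric-≪ q a k aq≤k = ℕ.*-cancelˡ-≤ q (begin
  q * (a * q ^ k)    ≡⟨ eq q a (q ^ k) ⟩
  a * q * q ^ k      ≤⟨ ℕ.*-monoˡ-≤ (q ^ k) (ℕ.≤-trans aq≤k (ℕ.m≤n+m k q)) ⟩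
  (q + k) * q ^ k    ≤⟨ [q+k]*q^k≤q*[1+q]^k q k ⟩
  q * suc q ^ k      ∎)
  where
  open ℕ.≤-Reasoning
  eq : ∀ q a x → q * (a * x) ≡ a * q * x
  eq = ℕ-Solver.solve-∀

i-j≤k : ∀ {i j k} → i ≤ j + k → + i ℤ.- + j ℤ.≤ + k
i-j≤k {i} {j} {k} i≤j+k = subst (+ i ℤ.- + j ℤ.≤_) (eq (+ j) (+ k)) (ℤ.+-monoˡ-≤ (ℤ.- + j) (ℤ.+≤+ i≤j+k))
  where
  eq : ∀ j k → j ℤ.+ k ℤ.- j ≡ k
  eq = ℤ-Solver.solve-∀

k≤i-j : ∀ {i j k} → j + k ≤ i → + k ℤ.≤ + i ℤ.- + j
k≤i-j {i} {j} {k} j+k≤i = subst (ℤ._≤ + i ℤ.- + j) (eq (+ j) (+ k)) (ℤ.+-monoˡ-≤ (ℤ.- + j) (ℤ.+≤+ j+k≤i))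
  where
  eq : ∀ j k → j ℤ.+ k ℤ.- j ≡ k
  eq = ℤ-Solver.solve-∀

-- D = δ gives M° and D = 0 gives M, with j for the paper's k - 1.  Positive and negative
-- terms are kept apart so that the estimates take place in ℕ.
module Maximum (p : ℕ) .{{p>1 : NonTrivial p}} (D : ℕ → ℕ) (c : ℕ)
               (D≤c*[p-1]^k : ∀ k → D k ≤ c * pred p ^ k) (j₀ : ℕ) where
  private
    instance
      p≢0 : NonZero p
      p≢0 = ℕ.nonTrivial⇒nonZero p

    1<p : 1 < p
    1<p = ℕ.nonTrivial⇒n>1 p

    -- The threshold of `geometric-≪` for the factor `4 * c`. From `K` on, `D k` is at most a
    -- quarter of `p ^ k`; together with `p ^ j`, at most half of `p ^ suc j`, this leaves a quarter
    -- of `p ^ suc j` to be bounded by `n` in `Admissible`.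
    K : ℕ
    K = 4 * c * pred p

    4D≤p^k : ∀ {k} → K ≤ k → 4 * D k ≤ p ^ k
    4D≤p^k {k} K≤k = begin
      4 * D k                ≤⟨ ℕ.*-monoʳ-≤ 4 (D≤c*[p-1]^k k) ⟩
      4 * (c * pred p ^ k)   ≡⟨ ℕ.*-assoc 4 c (pred p ^ k) ⟨
      4 * c * pred p ^ k     ≤⟨ geometric-≪ (pred p) {{ℕ.>-nonZero (ℕ.pred-mono-≤ 1<p)}} (4 * c) k K≤k ⟩
      suc (pred p) ^ k       ≡⟨ cong (_^ k) (ℕ.suc-pred p) ⟩
      p ^ k                  ∎
      where open ℕ.≤-Reasoning

    D≤c*p^k : ∀ k → D k ≤ c * p ^ k
    D≤c*p^k k = ℕ.≤-trans (D≤c*[p-1]^k k) (ℕ.*-monoʳ-≤ c (ℕ.^-monoˡ-≤ k ℕ.pred[n]≤n))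

    2*p^j≤p^1+j : ∀ j → 2 * p ^ j ≤ p ^ suc j
    2*p^j≤p^1+j j = ℕ.*-monoˡ-≤ (p ^ j) 1<p

  Admissible : ℕ → ℕ → Set
  Admissible n j = p ^ suc j + D j ≤ n + p ^ j + D (suc j)

  pos neg : ℕ → ℕ → ℕ
  pos n j = suc j * (n + p ^ j) + j * D (suc j)
  neg n j = j * p ^ suc j + suc j * D j

  value : ℕ → ℕ → ℤ
  value n j = + pos n j ℤ.- + neg n j

  -- `j₀` is the least allowed value of k - 1: 0 for M and 1 for M°.
  Values : ℕ → Pred ℤ 0ℓ
  Values n v = ∃[ j ] (j₀ ≤ j × Admissible n j) × v ≡ value n j

  private
    -- With y = p^(j+1), the constraint gives y ≤ n + y/2 + y/4; the factor 4 clears the fractions.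
    admissible⇒p^1+j≤4n : ∀ {n j} → K ≤ suc j → Admissible n j → p ^ suc j ≤ 4 * n
    admissible⇒p^1+j≤4n {n} {j} K≤ adm = ℕ.+-cancelʳ-≤ (3 * y) y (4 * n) (begin
      y + 3 * y                  ≤⟨ ℕ.*-monoʳ-≤ 4 (ℕ.≤-trans (ℕ.m≤m+n y (D j)) adm) ⟩
      4 * (n + x + D (suc j))    ≡⟨ eq n x (D (suc j)) ⟩
      4 * n + (2 * (2 * x) + 4 * D (suc j))
        ≤⟨ ℕ.+-monoʳ-≤ (4 * n) (ℕ.+-mono-≤ (ℕ.*-monoʳ-≤ 2 (2*p^j≤p^1+j j)) (4D≤p^k K≤)) ⟩
      4 * n + (2 * y + y)        ≡⟨ cong (λ t → 4 * n + t) (eq′ y) ⟩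
      4 * n + 3 * y              ∎)
      where
      open ℕ.≤-Reasoning
      x = p ^ j
      y = p ^ suc j
      eq : ∀ n x d → 4 * (n + x + d) ≡ 4 * n + (2 * (2 * x) + 4 * d)
      eq = ℕ-Solver.solve-∀
      eq′ : ∀ y → 2 * y + y ≡ 3 * y
      eq′ = ℕ-Solver.solve-∀

    -- A crude bound, needed only to make the search for the maximum finite.
    admissible⇒j<K+4n : ∀ {n j} → Admissible n j → j < K + 4 * n
    admissible⇒j<K+4n {n} {j} adm with K ℕ.≤? suc j
    ... | yes K≤ = begin-strict
      j           <⟨ ℕ.≤-refl ⟩
      suc j       ≤⟨ ℕ.<⇒≤ (n<b^n p (suc j)) ⟩
      p ^ suc j   ≤⟨ admissible⇒p^1+j≤4n {n} {j} K≤ adm ⟩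
      4 * n       ≤⟨ ℕ.m≤n+m (4 * n) K ⟩
      K + 4 * n   ∎
      where open ℕ.≤-Reasoning
    ... | no K≰ = ℕ.≤-trans (ℕ.<⇒≤ (ℕ.≰⇒> K≰)) (ℕ.m≤m+n K (4 * n))

  maximum : ∀ n → ∃ (IsMax (Values n))
  maximum n = bounded⇒IsMax
    (λ j → j₀ ℕ.≤? j ×-dec p ^ suc j + D j ℕ.≤? n + p ^ j + D (suc j))
    (value n) (K + 4 * n) (λ {j} (_ , adm) → admissible⇒j<K+4n {n} {j} adm)

  private
    -- The O(n) error of the upper bound is `C * n`: 5 comes from `3 + j` with `j ≤ 2 + l` for large
    -- `j`, and `K + K` from `small-j`.
    C : ℕ
    C = 5 + (K + K)

    -- With y = p^(j+1), the terms of `pos` beyond (j+1)n are at most (j+1)y/2 + jy/4 ≤ jy + y/2.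
    -- The summand `j * y` of `neg` cancels the first part, and y/2 ≤ 2n by admissibility. All is
    -- multiplied by 4.
    large-j : ∀ {n j} → K ≤ suc j → Admissible n j → pos n j ≤ neg n j + (3 + j) * n
    large-j {n} {j} K≤ adm = ℕ.*-cancelˡ-≤ 4 (begin
      4 * (suc j * (n + x) + j * D (suc j))     ≡⟨ eq j n x (D (suc j)) ⟩
      4 * suc j * n + (2 * suc j * (2 * x) + j * (4 * D (suc j)))
        ≤⟨ ℕ.+-monoʳ-≤ (4 * suc j * n) (ℕ.+-mono-≤
             (ℕ.*-monoʳ-≤ (2 * suc j) (2*p^j≤p^1+j j)) (ℕ.*-monoʳ-≤ j (4D≤p^k K≤))) ⟩
      4 * suc j * n + (2 * suc j * y + j * y)    ≤⟨ ℕ.m≤m+n _ (j * y) ⟩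
      4 * suc j * n + (2 * suc j * y + j * y) + j * y ≡⟨ eq′ (4 * suc j * n) j y ⟩
      4 * suc j * n + 4 * (j * y) + 2 * y
        ≤⟨ ℕ.+-monoʳ-≤ (4 * suc j * n + 4 * (j * y))
             (ℕ.*-monoʳ-≤ 2 (admissible⇒p^1+j≤4n {n} {j} K≤ adm)) ⟩
      4 * suc j * n + 4 * (j * y) + 2 * (4 * n)  ≤⟨ ℕ.m≤m+n _ (4 * (suc j * D j)) ⟩
      4 * suc j * n + 4 * (j * y) + 2 * (4 * n) + 4 * (suc j * D j) ≡⟨ eq″ j n (j * y) (suc j * D j) ⟩
      4 * (j * y + suc j * D j + (3 + j) * n)    ∎)
      where
      open ℕ.≤-Reasoning
      x = p ^ j
      y = p ^ suc j
      eq : ∀ j n x d → 4 * ((1 + j) * (n + x) + j * d) ≡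
                       4 * (1 + j) * n + (2 * (1 + j) * (2 * x) + j * (4 * d))
      eq = ℕ-Solver.solve-∀
      eq′ : ∀ t j y → t + (2 * (1 + j) * y + j * y) + j * y ≡ t + 4 * (j * y) + 2 * y
      eq′ = ℕ-Solver.solve-∀
      eq″ : ∀ j n z w → 4 * (1 + j) * n + 4 * z + 2 * (4 * n) + 4 * w ≡ 4 * (z + w + (3 + j) * n)
      eq″ = ℕ-Solver.solve-∀

    -- Below the threshold `K` the powers and the `D` terms are bounded by constants, which `n`
    -- dominates once it is at least `suc c * p ^ K`.
    small-j : ∀ {n j} → suc j ≤ K → suc c * p ^ K ≤ n → pos n j ≤ (K + K) * n
    small-j {n} {j} j<K N≤n = begin
      suc j * (n + p ^ j) + j * D (suc j)
        ≤⟨ ℕ.+-mono-≤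
             (ℕ.*-mono-≤ j<K (ℕ.+-monoʳ-≤ n (ℕ.^-monoʳ-≤ p (ℕ.<⇒≤ j<K))))
             (ℕ.*-mono-≤ (ℕ.<⇒≤ j<K)
               (ℕ.≤-trans (D≤c*p^k (suc j)) (ℕ.*-monoʳ-≤ c (ℕ.^-monoʳ-≤ p j<K)))) ⟩
      K * (n + p ^ K) + K * (c * p ^ K)  ≡⟨ eq K n c (p ^ K) ⟩
      K * n + K * (suc c * p ^ K)        ≤⟨ ℕ.+-monoʳ-≤ (K * n) (ℕ.*-monoʳ-≤ K N≤n) ⟩
      K * n + K * n                      ≡⟨ ℕ.*-distribʳ-+ n K K ⟨
      (K + K) * n                        ∎
      where
      open ℕ.≤-Reasoning
      eq : ∀ k n c z → k * (n + z) + k * (c * z) ≡ k * n + k * ((1 + c) * z)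
      eq = ℕ-Solver.solve-∀

    p^1+j≤4n⇒j≤2+l : ∀ {n j l} → n < p ^ (l + 2) → p ^ suc j ≤ 4 * n → j ≤ 2 + l
    p^1+j≤4n⇒j≤2+l {n} {j} {l} n<p^l+2 le = ℕ.s≤s⁻¹ (ℕ.s≤s⁻¹ (b^m<b^n⇒m<n p (begin-strict
      p ^ suc j               ≤⟨ le ⟩
      4 * n                   <⟨ ℕ.*-monoʳ-< 4 n<p^l+2 ⟩
      -- `4 ≤ p ^ 2` because `p` is at least 2.
      4 * p ^ (l + 2)         ≤⟨ ℕ.*-monoˡ-≤ (p ^ (l + 2)) (ℕ.^-monoˡ-≤ 2 1<p) ⟩
      p ^ 2 * p ^ (l + 2)     ≡⟨ ℕ.^-distribˡ-+-* p 2 (l + 2) ⟨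
      p ^ (2 + (l + 2))       ≡⟨ cong (λ t → p ^ (2 + t)) (ℕ.+-comm l 2) ⟩
      p ^ (4 + l)             ∎)))
      where open ℕ.≤-Reasoning

    value-≤ : ∀ {n j l} → suc c * p ^ K ≤ n → n < p ^ (l + 2) → Admissible n j →
              value n j ℤ.≤ + ((l + C) * n)
    value-≤ {n} {j} {l} N≤n n<p^l+2 adm = i-j≤k {pos n j} pos≤
      where
      open ℕ.≤-Reasoning
      pos≤ : pos n j ≤ neg n j + (l + C) * n
      pos≤ with K ℕ.≤? suc j
      ... | yes K≤ = begin
        pos n j                    ≤⟨ large-j {n} {j} K≤ adm ⟩
        neg n j + (3 + j) * n      ≤⟨ ℕ.+-monoʳ-≤ (neg n j) (ℕ.*-monoˡ-≤ n 3+j≤) ⟩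
        neg n j + (l + C) * n      ∎
        where
        3+j≤ : 3 + j ≤ l + C
        3+j≤ = begin
          3 + j            ≤⟨ ℕ.+-monoʳ-≤ 3 (p^1+j≤4n⇒j≤2+l {n} n<p^l+2
                                (admissible⇒p^1+j≤4n {n} {j} K≤ adm)) ⟩
          5 + l            ≡⟨ ℕ.+-comm 5 l ⟩
          l + 5            ≤⟨ ℕ.+-monoʳ-≤ l (ℕ.m≤m+n 5 (K + K)) ⟩
          l + C            ∎
      ... | no K≰ = begin
        pos n j                    ≤⟨ small-j {n} {j} (ℕ.<⇒≤ (ℕ.≰⇒> K≰)) N≤n ⟩
        (K + K) * n                ≤⟨ ℕ.*-monoˡ-≤ n (ℕ.≤-trans (ℕ.m≤n+m (K + K) 5) (ℕ.m≤n+m C l)) ⟩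
        (l + C) * n                ≤⟨ ℕ.m≤n+m _ (neg n j) ⟩
        neg n j + (l + C) * n      ∎

  -- A nearly optimal index and the asymptotics of the maximum

  module _ (E : ℕ) .{{E≢0 : NonZero E}} where
    private
      -- The chosen k is `l` minus this constant, so that `s < p ^ s` yields `s * p ^ k ≤ n`. The
      -- factor `suc c` absorbs the `D` term, and `2 * E` makes `neg` at most the fraction 1/(2E) of
      -- k n.
      s : ℕ
      s = 2 * suc c * E

    scale-≤ : ∀ {n j} → p ^ (suc j + s) < n → s * p ^ suc j ≤ n
    scale-≤ {n} {j} lt = begin
      s * p ^ suc j        ≤⟨ ℕ.*-monoˡ-≤ (p ^ suc j) (ℕ.<⇒≤ (n<b^n p s)) ⟩
      p ^ s * p ^ suc j    ≡⟨ ℕ.*-comm (p ^ s) (p ^ suc j) ⟩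
      p ^ suc j * p ^ s    ≡⟨ ℕ.^-distribˡ-+-* p (suc j) s ⟨
      p ^ (suc j + s)      ≤⟨ ℕ.<⇒≤ lt ⟩
      n                    ∎
      where open ℕ.≤-Reasoning

    module _ {n j} (n-large : s * p ^ suc j ≤ n) where
      open ℕ.≤-Reasoning
      private
        y = p ^ suc j

        p^j≤y : p ^ j ≤ y
        p^j≤y = ℕ.^-monoʳ-≤ p (ℕ.n≤1+n j)

      admissible : Admissible n j
      admissible = begin
        y + D j              ≤⟨ ℕ.+-monoʳ-≤ y (ℕ.≤-trans (D≤c*p^k j) (ℕ.*-monoʳ-≤ c p^j≤y)) ⟩
        suc c * y            ≤⟨ ℕ.*-monoˡ-≤ y (ℕ.≤-trans (ℕ.m≤n*m (suc c) 2) (ℕ.m≤m*n (2 * suc c) E)) ⟩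
        s * y                ≤⟨ n-large ⟩
        n                    ≤⟨ ℕ.m≤m+n n (p ^ j) ⟩
        n + p ^ j            ≤⟨ ℕ.m≤m+n _ (D (suc j)) ⟩
        n + p ^ j + D (suc j)  ∎

      2E*neg≤ : 2 * E * neg n j ≤ suc j * n
      2E*neg≤ = begin
        2 * E * (j * y + suc j * D j)
          ≤⟨ ℕ.*-monoʳ-≤ (2 * E) (ℕ.+-mono-≤ (ℕ.*-monoˡ-≤ y (ℕ.n≤1+n j))
               (ℕ.*-monoʳ-≤ (suc j) (ℕ.≤-trans (D≤c*p^k j) (ℕ.*-monoʳ-≤ c p^j≤y)))) ⟩
        2 * E * (suc j * y + suc j * (c * y))   ≡⟨ eq E (suc j) y c ⟩
        suc j * (s * y)                         ≤⟨ ℕ.*-monoʳ-≤ (suc j) n-large ⟩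
        suc j * n                               ∎
        where
        eq : ∀ e k y c → 2 * e * (k * y + k * (c * y)) ≡ k * (2 * (1 + c) * e * y)
        eq = ℕ-Solver.solve-∀

      -- Here `suc j + s` is `l`. The permitted error n l is spent in two halves: k n / 2 pays for
      -- `neg`, and another k n / 2 for the distance `s + 2` between k and `l + 2`.
      E*n*[l+2]≤ : 2 * E * (s + 2) ≤ suc j →
        E * neg n j + E * (n * (suc j + s + 2)) ≤ E * pos n j + n * (suc j + s)
      E*n*[l+2]≤ k-large = ℕ.*-cancelˡ-≤ 2 (begin
        2 * (E * neg n j + E * (n * (k + s + 2)))   ≡⟨ eq E (neg n j) n k s ⟩
        2 * E * neg n j + (n * (2 * E * (s + 2)) + 2 * E * (k * n))
          ≤⟨ ℕ.+-mono-≤ 2E*neg≤ (ℕ.+-monoˡ-≤ (2 * E * (k * n)) (ℕ.*-monoʳ-≤ n k-large)) ⟩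
        k * n + (n * k + 2 * E * (k * n))           ≤⟨ ℕ.m≤m+n _ (2 * (n * s)) ⟩
        k * n + (n * k + 2 * E * (k * n)) + 2 * (n * s) ≡⟨ eq′ E n k s ⟩
        2 * (E * (k * n) + n * (k + s))
          ≤⟨ ℕ.*-monoʳ-≤ 2 (ℕ.+-monoˡ-≤ (n * (k + s)) (ℕ.*-monoʳ-≤ E (ℕ.≤-trans
               (ℕ.*-monoʳ-≤ k (ℕ.m≤m+n n (p ^ j))) (ℕ.m≤m+n _ (j * D k))))) ⟩
        2 * (E * pos n j + n * (k + s))             ∎)
        where
        k = suc j
        eq : ∀ e m n k s → 2 * (e * m + e * (n * (k + s + 2))) ≡
                           2 * e * m + (n * (2 * e * (s + 2)) + 2 * e * (k * n))
        eq = ℕ-Solver.solve-∀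
        eq′ : ∀ e n k s → k * n + (n * k + 2 * e * (k * n)) + 2 * (n * s) ≡
                          2 * (e * (k * n) + n * (k + s))
        eq′ = ℕ-Solver.solve-∀

    private
      -- One summand for each demand on a large index: `EC≤l`, `k-large`, and membership in the
      -- range starting at `j₀`.
      k₀-1 k₀ : ℕ
      k₀-1 = E * C + 2 * E * (s + 2) + j₀
      k₀   = suc k₀-1

      N : ℕ
      -- The first summand forces `k₀ + s ≤ l`; the second is the threshold of `small-j`.
      N = p ^ (k₀ + s + 2) + suc c * p ^ K

    maximum-close : ∃[ N ] ∀ n → N ≤ n → ∀ {v} → IsMax (Values n) v → Close p E n v
    maximum-close = N , λ n N≤n {v} → close n N≤n {v}
      where
      module _ n (N≤n : N ≤ n) where
        open ℕ.≤-Reasoning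
        p^≤n : p ^ (k₀ + s + 2) ≤ n
        p^≤n = ℕ.≤-trans (ℕ.m≤m+n _ (suc c * p ^ K)) N≤n

        1<n : 1 < n
        1<n = ℕ.≤-<-trans (s≤s z≤n) (ℕ.<-≤-trans (n<b^n p (k₀ + s + 2)) p^≤n)

        close : ∀ {v} → IsMax (Values n) v → Close p E n v
        close {v} isMax with floor-log p n 1<n
        ... | l , p^l<n , n<p^l+2 = l , p^l<n , n<p^l+2 , above isMax , below isMax
          where
          k₀+s≤l : k₀ + s ≤ l
          k₀+s≤l = ℕ.<⇒≤ (ℕ.+-cancelʳ-< 2 (k₀ + s) l (b^m<b^n⇒m<n p (ℕ.≤-<-trans p^≤n n<p^l+2)))

          j : ℕ
          -- Makes k = `suc j` equal to `l - s`; the truncated subtraction is exact since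
          -- `suc s ≤ l`.
          j = l ∸ suc s

          l≡ : suc j + s ≡ l
          l≡ = trans (sym (ℕ.+-suc j s)) (ℕ.m∸n+n≡m (ℕ.≤-trans (s≤s (ℕ.m≤n+m s k₀-1)) k₀+s≤l))

          k₀-1≤j : k₀-1 ≤ j
          k₀-1≤j = ℕ.s≤s⁻¹ (ℕ.+-cancelʳ-≤ s k₀ (suc j) (subst (k₀ + s ≤_) (sym l≡) k₀+s≤l))

          n-large : s * p ^ suc j ≤ n
          n-large = scale-≤ {n} {j} (subst (λ t → p ^ t < n) (sym l≡) p^l<n)

          value∈ : Values n (value n j)
          value∈ = j , (ℕ.≤-trans (ℕ.m≤n+m j₀ _) k₀-1≤j , admissible {n} {j} n-large) , refl

          EC≤l : E * C ≤ l
          EC≤l = begin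
            E * C                           ≤⟨ ℕ.m≤m+n (E * C) (2 * E * (s + 2)) ⟩
            E * C + 2 * E * (s + 2)         ≤⟨ ℕ.m≤m+n _ j₀ ⟩
            k₀-1                            ≤⟨ k₀-1≤j ⟩
            j                               ≤⟨ ℕ.m∸n≤m l (suc s) ⟩
            l                               ∎

          k-large : 2 * E * (s + 2) ≤ suc j
          k-large = begin
            2 * E * (s + 2)                 ≤⟨ ℕ.m≤n+m (2 * E * (s + 2)) (E * C) ⟩
            E * C + 2 * E * (s + 2)         ≤⟨ ℕ.m≤m+n _ j₀ ⟩
            k₀-1                            ≤⟨ k₀-1≤j ⟩
            j                               ≤⟨ ℕ.n≤1+n j ⟩
            suc j                           ∎

          above : IsMax (Values n) v → + E ℤ.* v ℤ.≤ + E ℤ.* + (n * l) ℤ.+ + (n * l)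
          -- The default value 0 of an empty maximum cannot occur, as `value n j` is a member.
          above (inj₂ (empty , _)) = contradiction value∈ (empty _)
          above (inj₁ ((i , (_ , adm) , refl) , _)) = ℤ≤.begin
            + E ℤ.* value n i               ℤ≤.≤⟨ ℤ.*-monoˡ-≤-nonNeg (+ E)
              (value-≤ {n} {i} {l} (ℕ.≤-trans (ℕ.m≤n+m _ (p ^ (k₀ + s + 2))) N≤n) n<p^l+2 adm) ⟩
            + E ℤ.* + ((l + C) * n)         ℤ≤.≡⟨ ℤ.pos-* E ((l + C) * n) ⟨
            + (E * ((l + C) * n))           ℤ≤.≤⟨ ℤ.+≤+ (begin
              E * ((l + C) * n)               ≡⟨ eq E l C n ⟩
              -- Here the O(n) error becomes a relative error of at most 1 / E.
              E * (n * l) + n * (E * C)       ≤⟨ ℕ.+-monoʳ-≤ (E * (n * l)) (ℕ.*-monoʳ-≤ n EC≤l) ⟩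
              E * (n * l) + n * l             ∎) ⟩
            + (E * (n * l)) ℤ.+ + (n * l)   ℤ≤.≡⟨ cong (ℤ._+ + (n * l)) (ℤ.pos-* E (n * l)) ⟩
            + E ℤ.* + (n * l) ℤ.+ + (n * l) ℤ≤.∎
            where
            module ℤ≤ = ℤ.≤-Reasoning
            eq : ∀ e l c n → e * ((l + c) * n) ≡ e * (n * l) + n * (e * c)
            eq = ℕ-Solver.solve-∀

          below : IsMax (Values n) v → + E ℤ.* + (n * (l + 2)) ℤ.≤ + E ℤ.* v ℤ.+ + (n * l)
          below (inj₂ (empty , _)) = contradiction value∈ (empty _)
          below (inj₁ (_ , max)) = ℤ≤.begin
            + E ℤ.* + (n * (l + 2))        ℤ≤.≡⟨ ℤ.pos-* E (n * (l + 2)) ⟨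
            + (E * (n * (l + 2)))
              ℤ≤.≤⟨ k≤i-j {E * pos n j + n * l} {E * neg n j} {E * (n * (l + 2))}
                (subst (λ t → E * neg n j + E * (n * (t + 2)) ≤ E * pos n j + n * t) l≡
                  (E*n*[l+2]≤ {n} {j} n-large k-large)) ⟩
            + (E * pos n j) ℤ.+ + (n * l) ℤ.- + (E * neg n j)
              ℤ≤.≡⟨ cong₂ (λ a b → a ℤ.+ + (n * l) ℤ.- b)
                          (ℤ.pos-* E (pos n j)) (ℤ.pos-* E (neg n j)) ⟩
            + E ℤ.* + pos n j ℤ.+ + (n * l) ℤ.- + E ℤ.* + neg n j
              ℤ≤.≡⟨ eq (+ E) (+ pos n j) (+ (n * l)) (+ neg n j) ⟩
            + E ℤ.* value n j ℤ.+ + (n * l)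
              ℤ≤.≤⟨ ℤ.+-monoˡ-≤ (+ (n * l)) (ℤ.*-monoˡ-≤-nonNeg (+ E) (max value∈)) ⟩
            + E ℤ.* v ℤ.+ + (n * l)        ℤ≤.∎
            where
            module ℤ≤ = ℤ.≤-Reasoning
            eq : ∀ e a b c → e ℤ.* a ℤ.+ b ℤ.- e ℤ.* c ≡ e ℤ.* (a ℤ.- c) ℤ.+ b
            eq = ℤ-Solver.solve-∀

-- Translation between the integer formulas and their subtraction-free forms

constraint⇒admissible : ∀ p x d d′ n →
  + x ℤ.* (+ p ℤ.- 1ℤ) ℤ.- + d′ ℤ.+ + d ℤ.≤ + n → p * x + d ≤ n + x + d′
constraint⇒admissible p x d d′ n le = ℤ.drop‿+≤+ (subst₂ ℤ._≤_ lhs rhs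
  (ℤ.+-monoˡ-≤ (+ x ℤ.+ + d′) le))
  where
  eq : ∀ p x d d′ → x ℤ.* (p ℤ.- 1ℤ) ℤ.- d′ ℤ.+ d ℤ.+ (x ℤ.+ d′) ≡ p ℤ.* x ℤ.+ d
  eq = ℤ-Solver.solve-∀
  lhs : + x ℤ.* (+ p ℤ.- 1ℤ) ℤ.- + d′ ℤ.+ + d ℤ.+ (+ x ℤ.+ + d′) ≡ + (p * x + d)
  lhs = trans (eq (+ p) (+ x) (+ d) (+ d′)) (cong (ℤ._+ + d) (sym (ℤ.pos-* p x)))
  rhs : + n ℤ.+ (+ x ℤ.+ + d′) ≡ + (n + x + d′)
  rhs = cong +_ (sym (ℕ.+-assoc n x d′))

admissible⇒constraint : ∀ p x d d′ n →
  p * x + d ≤ n + x + d′ → + x ℤ.* (+ p ℤ.- 1ℤ) ℤ.- + d′ ℤ.+ + d ℤ.≤ + n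
admissible⇒constraint p x d d′ n le = subst (ℤ._≤ + n) lhs
  (i-j≤k {p * x + d} {x + d′} (subst (p * x + d ≤_) (eq′ n x d′) le))
  where
  eq : ∀ p x d d′ → p ℤ.* x ℤ.+ d ℤ.- (x ℤ.+ d′) ≡ x ℤ.* (p ℤ.- 1ℤ) ℤ.- d′ ℤ.+ d
  eq = ℤ-Solver.solve-∀
  eq′ : ∀ n x d′ → n + x + d′ ≡ x + d′ + n
  eq′ = ℕ-Solver.solve-∀
  lhs : + (p * x + d) ℤ.- + (x + d′) ≡ + x ℤ.* (+ p ℤ.- 1ℤ) ℤ.- + d′ ℤ.+ + d
  lhs = trans (cong (λ t → t ℤ.+ + d ℤ.- (+ x ℤ.+ + d′)) (ℤ.pos-* p x))
              (eq (+ p) (+ x) (+ d) (+ d′))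

-- With k = `suc j` and x = p^(k-1), this rests on x (k (p-1) - p) = (k-1) p x - k x; `d` and `d′`
-- stand for the corrections at k-1 and k.
value≡ : ∀ p x d d′ n j →
  + (suc j * (n + x) + j * d′) ℤ.- + (j * (p * x) + suc j * d) ≡
  + suc j ℤ.* + n ℤ.- + x ℤ.* (+ suc j ℤ.* (+ p ℤ.- 1ℤ) ℤ.- + p)
    ℤ.+ (+ suc j ℤ.- 1ℤ) ℤ.* + d′ ℤ.- + suc j ℤ.* + d
value≡ p x d d′ n j = begin
  + (suc j * (n + x) + j * d′) ℤ.- + (j * (p * x) + suc j * d)
    ≡⟨ cong₂ ℤ._-_ (cong₂ ℤ._+_ (ℤ.pos-* (suc j) (n + x)) (ℤ.pos-* j d′))
                   (cong₂ ℤ._+_ (trans (ℤ.pos-* j (p * x)) (cong (+ j ℤ.*_) (ℤ.pos-* p x)))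
                                (ℤ.pos-* (suc j) d)) ⟩
  + suc j ℤ.* (+ n ℤ.+ + x) ℤ.+ + j ℤ.* + d′ ℤ.- (+ j ℤ.* (+ p ℤ.* + x) ℤ.+ + suc j ℤ.* + d)
    ≡⟨ eq (+ p) (+ x) (+ d) (+ d′) (+ n) (+ j) ⟩
  + suc j ℤ.* + n ℤ.- + x ℤ.* (+ suc j ℤ.* (+ p ℤ.- 1ℤ) ℤ.- + p)
    ℤ.+ (+ suc j ℤ.- 1ℤ) ℤ.* + d′ ℤ.- + suc j ℤ.* + d ∎
  where
  open ≡-Reasoning
  eq : ∀ p x d d′ n j →
    (1ℤ ℤ.+ j) ℤ.* (n ℤ.+ x) ℤ.+ j ℤ.* d′ ℤ.- (j ℤ.* (p ℤ.* x) ℤ.+ (1ℤ ℤ.+ j) ℤ.* d) ≡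
    (1ℤ ℤ.+ j) ℤ.* n ℤ.- x ℤ.* ((1ℤ ℤ.+ j) ℤ.* (p ℤ.- 1ℤ) ℤ.- p)
      ℤ.+ (1ℤ ℤ.+ j ℤ.- 1ℤ) ℤ.* d′ ℤ.- (1ℤ ℤ.+ j) ℤ.* d
  eq = ℤ-Solver.solve-∀

theorem4p10p5 : (P : FinPoset) .{{_ : NonZero (FinPoset.size P)}} →
    (∃ λ (M : ℕ → ℤ) → ((n : ℕ) .{{_ : NonZero n}} → IsM P n (M n))
    × M ∼ n·log (#filters P) {{#filters-nonTrivial P}})
    × (∃ λ (M° : ℕ → ℤ) → ((n : ℕ) .{{_ : NonZero n}} → IsM° P n (M° n))
    × M° ∼ n·log (#filters P) {{#filters-nonTrivial P}})
theorem4p10p5 P = (M , (λ n → isM n) , M∼) , (M° , (λ n → isM° n) , M°∼)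
  where
  p = #filters P

  instance
    p>1 : NonTrivial p
    p>1 = #filters-nonTrivial P

  1+pred≡p : p ≡ suc (pred p)
  1+pred≡p = sym (ℕ.suc-pred p {{ℕ.nonTrivial⇒nonZero p}})

  module Plain  = Maximum p (λ _ → 0) 0 (λ _ → z≤n) 0
  -- The constant is the number of points of `P`, from `δ-≤`; the starting index 1 encodes k ≥ 2.
  module Proper = Maximum p (δ P) (FinPoset.size P) (δ-≤ P 1+pred≡p) 1

  drop-δ : ∀ a → a ℤ.- 0ℤ ℤ.+ 0ℤ ≡ a
  drop-δ = ℤ-Solver.solve-∀

  drop-0δ : ∀ a b c → a ℤ.+ b ℤ.* 0ℤ ℤ.- c ℤ.* 0ℤ ≡ a
  drop-0δ = ℤ-Solver.solve-∀

  Plain⇒MSet : ∀ {n v} → Plain.Values n v → MSet P n v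
  Plain⇒MSet {n} (j , (_ , adm) , v≡) = suc j , s≤s z≤n
    , subst (ℤ._≤ + n) (drop-δ _) (admissible⇒constraint p (p ^ j) 0 0 n adm)
    , trans v≡ (trans (value≡ p (p ^ j) 0 0 n j) (drop-0δ _ (+ j) (+ suc j)))

  MSet⇒Plain : ∀ {n v} → MSet P n v → Plain.Values n v
  MSet⇒Plain {n} (suc j , _ , le , v≡) =
    j , (z≤n , constraint⇒admissible p (p ^ j) 0 0 n (subst (ℤ._≤ + n) (sym (drop-δ _)) le))
      , trans v≡ (trans (sym (drop-0δ _ (+ j) (+ suc j))) (sym (value≡ p (p ^ j) 0 0 n j)))

  Proper⇒M°Set : ∀ {n v} → Proper.Values n v → M°Set P n v
  Proper⇒M°Set {n} (j , (1≤j , adm) , v≡) = suc j , s≤s 1≤j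
    , admissible⇒constraint p (p ^ j) (δ P j) (δ P (suc j)) n adm
    , trans v≡ (value≡ p (p ^ j) (δ P j) (δ P (suc j)) n j)

  M°Set⇒Proper : ∀ {n v} → M°Set P n v → Proper.Values n v
  M°Set⇒Proper {n} (suc j , 2≤1+j , le , v≡) =
    j , (ℕ.s≤s⁻¹ 2≤1+j , constraint⇒admissible p (p ^ j) (δ P j) (δ P (suc j)) n le)
      , trans v≡ (sym (value≡ p (p ^ j) (δ P j) (δ P (suc j)) n j))

  M-exists : ∀ n → ∃ (IsM P n)
  M-exists n with + p ℤ.- 1ℤ ℤ.≤? + n
  ... | yes p-1≤n = let m , isMax = Plain.maximum n in
    m , (λ _ → IsMax-resp Plain⇒MSet MSet⇒Plain isMax) , (λ p-1≰n → contradiction p-1≤n p-1≰n)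
  ... | no p-1≰n = 1ℤ , (λ p-1≤n → contradiction p-1≤n p-1≰n) , (λ _ → refl)

  M M° : ℕ → ℤ
  M  n = proj₁ (M-exists n)
  M° n = proj₁ (Proper.maximum n)

  isM : ∀ n → IsM P n (M n)
  isM n = proj₂ (M-exists n)

  isM° : ∀ n → IsM° P n (M° n)
  isM° n = IsMax-resp Proper⇒M°Set M°Set⇒Proper (proj₂ (Proper.maximum n))

  M∼ : M ∼ n·log p
  M∼ = ∼-intro p λ E → let N , close = Plain.maximum-close E in
    -- Adding `p` ensures p - 1 ≤ n, so that `M n` is the maximum and not the default 1.
    N + p , λ n N+p≤n → close n (ℕ.≤-trans (ℕ.m≤m+n N p) N+p≤n)
      (IsMax-resp MSet⇒Plain Plain⇒MSet (proj₁ (isM n)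
        (i-j≤k {p} {1} (ℕ.m≤n⇒m≤1+n (ℕ.≤-trans (ℕ.m≤n+m p N) N+p≤n)))))

  M°∼ : M° ∼ n·log p
  M°∼ = ∼-intro p λ E → let N , close = Proper.maximum-close E in
    N , λ n N≤n → close n N≤n (proj₂ (Proper.maximum n))
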